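{- Let $q$ be a power of a prime $p$. Let $X$ be a subset of the point set of $\mathrm{PG}(2,q)$ whose characteristic vector is a codeword of $C_1(2,q)$, and let $Q$ be a point of $\mathrm{PG}(2,q)$. Let $\lambda$ be an integer with $\lambda\le\min\{q-2,p-1\}$ and let $\mathcal{E}_\lambda$ be a non-empty set of lines through $Q$, each of them incident with at most $\lambda$ points of $X\setminus\{Q\}$. Then the points of $X\setminus\{Q\}$ incident with lines of $\mathcal{E}_\lambda$ are on a curve of degree $\lambda$.
   Context: $C_1(2,q)$ denotes the $p$-ary linear code generated by the incidence (characteristic) vectors of the lines of $\mathrm{PG}(2,q)$, i.e. the $\mathbb{F}_p$-span of these vectors inside the space of $\mathbb{F}_p$-valued functions on the points of $\mathrm{PG}(2,q)$. A curve of degree $n$ is an algebraic curve of $\mathrm{PG}(2,q)$ given by a nonzero homogeneous polynomial in $\mathbb{F}_q[X,Y,Z]$ of degree $n$; a point is on the curve if the polynomial vanishes at it. -}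

module Defs where

open import Algebra.Bundles using (CommutativeRing)
import Algebra.Properties.CommutativeSemigroup as CommutativeSemigroup
import Algebra.Properties.Semiring.Exp as Exp
import Algebra.Properties.Semiring.Sum as Sum
open import Data.Bool.Base using (if_then_else_)
open import Data.Fin.Base using (Fin)
open import Data.Fin.Patterns using (0F; 1F; 2F)
open import Data.Fin.Properties using () renaming (_≟_ to _≟ᶠ_)
open import Data.Integer.Base as ℤ using (ℤ; +_)
import Data.Integer.Divisibility.Signed as ℤ
open import Data.List.Base using (List; []; _∷_)
open import Data.Nat.Base as ℕ using (ℕ)
import Data.Nat.Properties as ℕ
open import Data.Product.Base using (∃; _×_; _,_; proj₁)
open import Data.Product.Properties using (≡-dec)
open import Data.Vec.Functional using (Vector)
open import Function.Bundles using (Inverse)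
open import Function.Properties.Inverse using (Inverse⇒Injection)
open import Level using (Level; _⊔_) renaming (suc to lsuc)
open import Relation.Binary.Bundles using (Setoid)
import Relation.Binary.Construct.On as On
import Relation.Binary.Definitions as B
import Relation.Binary.Reasoning.Setoid as ≈-Reasoning
open import Relation.Binary.PropositionalEquality.Core using (_≡_; _≢_)
import Relation.Binary.PropositionalEquality.Properties as ≡
open import Relation.Nullary.Decidable.Core using (does)
open import Relation.Nullary.Decidable using (via-injection)
open import Relation.Nullary.Negation.Core using (¬_)
open import Relation.Unary using (Pred; Decidable)

private
  variable
    a b m : Level

------------------------------------------------------------------------
-- Finite sets and their subsets

HasSize : Setoid a b → ℕ → Set (a ⊔ b)
HasSize S n = Inverse S (≡.setoid (Fin n))

-- Only subsets of finite sets are considered below, so membership is taken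
-- to be decidable.

record Subset (S : Setoid a b) (m : Level) : Set (a ⊔ b ⊔ lsuc m) where
  open Setoid S using (Carrier; _≈_)
  field
    member   : Pred Carrier m
    respects : member B.Respects _≈_
    member?  : Decidable member

infix 4 _∈_

_∈_ : {S : Setoid a b} → Setoid.Carrier S → Subset S m → Set m
x ∈ A = Subset.member A x

-- The integer k is not assumed to be nonnegative.

AtMost : (S : Setoid a b) → ℤ → Pred (Setoid.Carrier S) m → Set (a ⊔ b ⊔ m)
AtMost S k A =
  ∃ λ n → HasSize (On.setoid S (proj₁ {B = A})) n × + n ℤ.≤ k

------------------------------------------------------------------------
-- Finite fields

record FiniteField (q : ℕ) (a b : Level) : Set (lsuc (a ⊔ b)) where
  field
    commutativeRing : CommutativeRing a b
  open CommutativeRing commutativeRing public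
  field
    1≉0     : ¬ 1# ≈ 0#
    inverse : ∀ x → ¬ x ≈ 0# → ∃ λ y → x * y ≈ 1#
    size    : HasSize setoid q

  _≟_ : B.Decidable _≈_
  _≟_ = via-injection (Inverse⇒Injection size) _≟ᶠ_

------------------------------------------------------------------------
-- The plane PG(2,q) over the field F of order q

module PG2 {q : ℕ} (F : FiniteField q a b) where

  open FiniteField F
  open Exp semiring using (_^_)
  open Sum semiring using (sum; sum-cong-≋; *-distribˡ-sum)

  -- Homogeneous coordinates: nonzero vectors of F³ up to a nonzero scalar.
  -- They serve for points and, dually, for lines: the line with coordinates
  -- l consists of the points v with l₀ v₀ + l₁ v₁ + l₂ v₂ = 0.

  record Coordinates : Set (a ⊔ b) where
    field
      vec     : Vector Carrier 3
      nonzero : ∃ λ i → ¬ vec i ≈ 0#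

  open Coordinates public

  infix 4 _∼_

  _∼_ : Coordinates → Coordinates → Set (a ⊔ b)
  u ∼ v = ∃ λ c → ¬ c ≈ 0# × (∀ i → vec v i ≈ c * vec u i)

  private
    ∼-refl : B.Reflexive _∼_
    ∼-refl = 1# , 1≉0 , λ i → sym (*-identityˡ _)

    ∼-sym : B.Symmetric _∼_
    ∼-sym {u} {v} (c , c≉0 , v≈cu) with inverse c c≉0
    ... | d , cd≈1 = d , d≉0 , λ i → sym (begin
        d * vec v i        ≈⟨ *-congˡ (v≈cu i) ⟩
        d * (c * vec u i)  ≈⟨ *-assoc d c _ ⟨
        d * c * vec u i    ≈⟨ *-congʳ (trans (*-comm d c) cd≈1) ⟩
        1# * vec u i       ≈⟨ *-identityˡ _ ⟩
        vec u i            ∎)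
      where
      open ≈-Reasoning setoid
      d≉0 : ¬ d ≈ 0#
      d≉0 d≈0 = 1≉0 (trans (sym cd≈1) (trans (*-congˡ d≈0) (zeroʳ c)))

    ∼-trans : B.Transitive _∼_
    ∼-trans {u} {v} {w} (c , c≉0 , v≈cu) (d , d≉0 , w≈dv) =
      d * c , dc≉0 , λ i →
        trans (w≈dv i) (trans (*-congˡ (v≈cu i)) (sym (*-assoc d c _)))
      where
      open ≈-Reasoning setoid
      dc≉0 : ¬ d * c ≈ 0#
      dc≉0 dc≈0 with inverse d d≉0
      ... | e , de≈1 = c≉0 (begin
        c            ≈⟨ *-identityˡ c ⟨
        1# * c       ≈⟨ *-congʳ (trans (*-comm e d) de≈1) ⟨
        e * d * c    ≈⟨ *-assoc e d c ⟩
        e * (d * c)  ≈⟨ *-congˡ dc≈0 ⟩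
        e * 0#       ≈⟨ zeroʳ e ⟩
        0#           ∎)

  coordinates : Setoid (a ⊔ b) (a ⊔ b)
  coordinates = record
    { Carrier       = Coordinates
    ; _≈_           = _∼_
    ; isEquivalence = record
      { refl  = λ {u} → ∼-refl {u}
      ; sym   = λ {u} {v} → ∼-sym {u} {v}
      ; trans = λ {u} {v} {w} → ∼-trans {u} {v} {w}
      }
    }

  points lines : Setoid (a ⊔ b) (a ⊔ b)
  points = coordinates
  lines  = coordinates

  Point Line : Set (a ⊔ b)
  Point = Setoid.Carrier points
  Line  = Setoid.Carrier lines

  pointsOf : Line → Subset points b
  pointsOf l = record
    { member   = λ P → sum (λ i → vec l i * vec P i) ≈ 0#
    ; respects = λ { {P} {P′} (c , _ , P′≈cP) l·P≈0 → begin
        sum (λ i → vec l i * vec P′ i)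
          ≈⟨ sum-cong-≋ (λ i → trans (*-congˡ (P′≈cP i)) (x∙yz≈y∙xz (vec l i) c (vec P i))) ⟩
        sum (λ i → c * (vec l i * vec P i))
          ≈⟨ *-distribˡ-sum c (λ i → vec l i * vec P i) ⟨
        c * sum (λ i → vec l i * vec P i)  ≈⟨ *-congˡ l·P≈0 ⟩
        c * 0#                             ≈⟨ zeroʳ c ⟩
        0#                                 ∎ }
    ; member?  = λ P → sum (λ i → vec l i * vec P i) ≟ 0#
    }
    where
    open ≈-Reasoning setoid
    open CommutativeSemigroup *-commutativeSemigroup using (x∙yz≈y∙xz)

  ----------------------------------------------------------------------
  -- The code C₁(2,q)

  χ : Subset points m → Point → ℤ
  χ A P = if does (Subset.member? A P) then + 1 else + 0

  -- The field of p elements is ℤ with congruence modulo p as its equality,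
  -- so functions to it are integer-valued functions compared modulo p.

  combination : List (ℤ × Line) → Point → ℤ
  combination []            P = + 0
  combination ((c , l) ∷ t) P = c ℤ.* χ (pointsOf l) P ℤ.+ combination t P

  C₁ : ℕ → Pred (Point → ℤ) (a ⊔ b)
  C₁ p v = ∃ λ t → ∀ P → + p ℤ.∣ v P ℤ.- combination t P

  ----------------------------------------------------------------------
  -- Plane algebraic curves

  -- (i , j , k) stands for the monomial XⁱYʲZᵏ.

  Monomial : Set
  Monomial = ℕ × ℕ × ℕ

  degree : Monomial → ℕ
  degree (i , j , k) = i ℕ.+ j ℕ.+ k

  -- A polynomial in F[X,Y,Z] is a formal sum of terms, in which a monomial
  -- may occur repeatedly; `coefficient` collects its occurrences.

  Polynomial : Set a
  Polynomial = List (Carrier × Monomial)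

  _≟ᵐ_ : B.DecidableEquality Monomial
  _≟ᵐ_ = ≡-dec ℕ._≟_ (≡-dec ℕ._≟_ ℕ._≟_)

  coefficient : Polynomial → Monomial → Carrier
  coefficient []            e = 0#
  coefficient ((c , d) ∷ f) e =
    (if does (d ≟ᵐ e) then c else 0#) + coefficient f e

  evaluate : Polynomial → Vector Carrier 3 → Carrier
  evaluate []                    v = 0#
  evaluate ((c , i , j , k) ∷ f) v =
    c * (v 0F ^ i * v 1F ^ j * v 2F ^ k) + evaluate f v

  record Curve (n : ℕ) : Set (a ⊔ b) where
    field
      polynomial  : Polynomial
      nonzero     : ∃ λ e → ¬ coefficient polynomial e ≈ 0#
      homogeneous : ∀ e → degree e ≢ n → coefficient polynomial e ≈ 0#

  _onCurve_ : ∀ {n} → Point → Curve n → Set b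
  P onCurve Γ = evaluate (Curve.polynomial Γ) (vec P) ≈ 0#

{-# OPTIONS --safe #-}

-- Let y be a linear form with y(Q) = 1. A vector v that is not a multiple of Q
-- spans with Q a line whose points other than Q are v + s Q, of height y(v) + s.
-- For 1 ≤ j ≤ q - 2, the sum of the j-th powers of the heights of the points of
-- X on that line is a form of degree j in v: this is additive over codewords,
-- a line l not through Q contributes (y(v) - l(v) / l(Q))ʲ, and a line through Q
-- contributes 0 since the j-th powers of all field elements sum to 0. As k = λ < p,
-- Newton's identities turn these power sums into forms c₀, …, c_k of degrees
-- 0, …, k, and Γ : ∑ c_j y^(k-j) = 0 is a curve of degree k. On a line with at
-- most k heights, ∑ c_j y^(k-j) is a multiple of the product of the (y - height),
-- so Γ contains the points of X there. Finally Γ(Q) = 1, so Γ is not identically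
-- zero.
module Submission where

open import Defs

import Algebra.Properties.AbelianGroup as AbelianGroupProperties
import Algebra.Properties.CommutativeMonoid.Sum as CommutativeSum
import Algebra.Properties.CommutativeSemiring.Exp as CommutativeExp
import Algebra.Properties.Group as GroupProperties
import Algebra.Properties.Monoid.Mult.TCOptimised as MonoidMult
import Algebra.Properties.Ring as RingProperties
import Algebra.Properties.Semiring.Exp as Exp
import Algebra.Properties.Semiring.Mult.TCOptimised as SemiringMult
import Algebra.Properties.Semiring.Sum as Sum
import Algebra.Solver.Ring as RingSolver
import Data.Fin.Properties as Fin
import Data.Integer.Divisibility.Signed as ℤ
import Data.Integer.Properties as ℤ
import Data.List.Properties as List
import Data.List.Relation.Unary.All.Properties as All
import Data.List.Relation.Unary.Any.Properties as Any
import Data.List.Relation.Unary.Unique.Propositional.Properties as Unique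
import Data.Maybe.Base as Maybe
import Data.Nat.Coprimality as Coprimality
import Data.Nat.GCD as GCD
import Data.Nat.Properties as ℕ
import Level
import Relation.Binary.Construct.On as On
import Relation.Binary.PropositionalEquality as ≡
import Relation.Binary.Reasoning.Setoid as ≈-Reasoning
open import Algebra.Bundles using (CommutativeRing)
open import Algebra.Solver.Ring.AlmostCommutativeRing using (fromCommutativeRing; _-Raw-AlmostCommutative⟶_)
open import Data.Bool.Base using (true; false; if_then_else_)
open import Data.Fin.Base using (Fin; zero; suc; punchIn; inject≤)
open import Data.Fin.Patterns using (0F; 1F; 2F)
open import Data.Fin.Permutation using (Permutation; permutation)
open import Data.Integer.Base as ℤ using (ℤ; +_; -[1+_])
open import Data.List.Base as List using (List; []; _∷_; _++_; length)
open import Data.List.Membership.Propositional.Properties using (∈-filter⁺; ∈-filter⁻; ∈-allFin; ∈-lookup)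
open import Data.List.Relation.Unary.All as All using (All; []; _∷_)
open import Data.List.Relation.Unary.AllPairs using (_∷_)
open import Data.List.Relation.Unary.Any as Any using (Any; here; there)
open import Data.List.Relation.Unary.Unique.Propositional using (Unique)
open import Data.Nat.Base as ℕ using (ℕ; zero; suc; _≤_; _<_; z≤n; s≤s)
open import Data.Nat.Primality using (Prime)
open import Data.Nat.Tactic.RingSolver using (solve-∀)
open import Data.Product.Base using (Σ; ∃; _×_; _,_; proj₁; proj₂)
open import Data.Vec.Base as Vec using (Vec; []; _∷_)
open import Data.Vec.Functional using (Vector)
open import Data.Vec.Relation.Binary.Pointwise.Inductive using (Pointwise; []; _∷_)
open import Function.Base using (_∘_; id)
open import Function.Bundles using (Injection; Inverse)
open import Function.Properties.Inverse using (Inverse⇒Injection)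
open import Relation.Binary.PropositionalEquality.Core using (_≡_; _≢_)
open import Relation.Nullary.Decidable using (Dec; yes; no; does; ¬?; dec⇒maybe; dec-true; dec-false)
open import Relation.Nullary.Negation using (contradiction)
open import Relation.Nullary.Negation.Core using (¬_)
open import Relation.Unary using (Decidable)

-- The canonical map from the integers to a commutative ring

module IntegerImage {a ℓ} (R : CommutativeRing a ℓ) where

  open CommutativeRing R hiding (zero)
  open RingProperties ring using (-‿distribˡ-*; -‿distribʳ-*)
  open AbelianGroupProperties +-abelianGroup using (⁻¹-∙-comm)
  open GroupProperties +-group using (⁻¹-involutive; ε⁻¹≈ε)
  open SemiringMult semiring using (1+×; ×1-homo-*; ×-homo-+) renaming (_×_ to _·_) public
  open ≈-Reasoning setoid

  -- The unique ring homomorphism from ℤ; through it integer-valued codewords acquire values in the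
  -- field.
  ι : ℤ → Carrier
  ι (+ n)    = n · 1#
  ι -[1+ n ] = - (suc n · 1#)

  ι-neg : ∀ i → ι (ℤ.- i) ≈ - ι i
  ι-neg (+ zero)  = sym ε⁻¹≈ε
  ι-neg (+ suc n) = refl
  ι-neg -[1+ n ]  = sym (⁻¹-involutive _)

  private
    cancel-1 : ∀ x y → 1# + x - (1# + y) ≈ x - y
    cancel-1 x y = begin
      1# + x - (1# + y)      ≈⟨ +-cong (+-comm 1# x) (sym (⁻¹-∙-comm 1# y)) ⟩
      x + 1# + (- 1# + - y)  ≈⟨ +-assoc x 1# _ ⟩
      x + (1# + (- 1# + - y))≈⟨ +-congˡ (+-assoc 1# _ _) ⟨
      x + (1# - 1# + - y)    ≈⟨ +-congˡ (+-congʳ (-‿inverseʳ 1#)) ⟩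
      x + (0# + - y)         ≈⟨ +-congˡ (+-identityˡ _) ⟩
      x - y                  ∎

  ι-⊖ : ∀ m n → ι (m ℤ.⊖ n) ≈ m · 1# - n · 1#
  ι-⊖ m zero = sym (trans (+-congˡ ε⁻¹≈ε) (+-identityʳ _))
  ι-⊖ zero (suc n) = sym (+-identityˡ _)
  ι-⊖ (suc m) (suc n) = begin
    ι (suc m ℤ.⊖ suc n)              ≡⟨ ≡.cong ι (ℤ.[1+m]⊖[1+n]≡m⊖n m n) ⟩
    ι (m ℤ.⊖ n)                      ≈⟨ ι-⊖ m n ⟩
    m · 1# - n · 1#                  ≈⟨ cancel-1 _ _ ⟨
    1# + m · 1# - (1# + n · 1#)      ≈⟨ +-cong (1+× m 1#) (-‿cong (1+× n 1#)) ⟨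
    suc m · 1# - suc n · 1#          ∎

  ι-+ : ∀ i j → ι (i ℤ.+ j) ≈ ι i + ι j
  ι-+ (+ m) (+ n) = ×-homo-+ 1# m n
  ι-+ (+ m) -[1+ n ] = ι-⊖ m (suc n)
  ι-+ -[1+ m ] (+ n) = trans (ι-⊖ n (suc m)) (+-comm _ _)
  ι-+ -[1+ m ] -[1+ n ] = begin
    - (suc (suc (m ℕ.+ n)) · 1#)        ≡⟨ ≡.cong (λ k → - (suc k · 1#)) (ℕ.+-suc m n) ⟨
    - ((suc m ℕ.+ suc n) · 1#)          ≈⟨ -‿cong (×-homo-+ 1# (suc m) (suc n)) ⟩
    - (suc m · 1# + suc n · 1#)         ≈⟨ ⁻¹-∙-comm _ _ ⟨
    - (suc m · 1#) - suc n · 1#         ∎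

  private
    ι-*-pos : ∀ i n → ι (i ℤ.* + n) ≈ ι i * ι (+ n)
    ι-*-pos (+ m) n = begin
      ι (+ m ℤ.* + n)  ≡⟨ ≡.cong ι (ℤ.pos-* m n) ⟨
      ι (+ (m ℕ.* n))  ≈⟨ ×1-homo-* m n ⟩
      ι (+ m) * ι (+ n) ∎
    ι-*-pos -[1+ m ] n = begin
      ι (-[1+ m ] ℤ.* + n)       ≡⟨ ≡.cong ι (ℤ.neg-distribˡ-* (+ suc m) (+ n)) ⟨
      ι (ℤ.- (+ suc m ℤ.* + n))  ≈⟨ ι-neg (+ suc m ℤ.* + n) ⟩
      - ι (+ suc m ℤ.* + n)      ≈⟨ -‿cong (ι-*-pos (+ suc m) n) ⟩
      - (ι (+ suc m) * ι (+ n))  ≈⟨ -‿distribˡ-* _ _ ⟩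
      ι -[1+ m ] * ι (+ n)       ∎

  ι-* : ∀ i j → ι (i ℤ.* j) ≈ ι i * ι j
  ι-* i (+ n) = ι-*-pos i n
  ι-* i -[1+ n ] = begin
    ι (i ℤ.* -[1+ n ])         ≡⟨ ≡.cong ι (ℤ.neg-distribʳ-* i (+ suc n)) ⟨
    ι (ℤ.- (i ℤ.* + suc n))    ≈⟨ ι-neg (i ℤ.* + suc n) ⟩
    - ι (i ℤ.* + suc n)        ≈⟨ -‿cong (ι-*-pos i (suc n)) ⟩
    - (ι i * ι (+ suc n))      ≈⟨ -‿distribʳ-* _ _ ⟩
    ι i * ι -[1+ n ]           ∎

  ι-homomorphism : ℤ.+-*-rawRing -Raw-AlmostCommutative⟶ fromCommutativeRing R
  ι-homomorphism = record
    { ⟦_⟧    = ι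
    ; +-homo = ι-+
    ; *-homo = ι-*
    ; -‿homo = ι-neg
    ; 0-homo = refl
    ; 1-homo = refl
    }

  -- Integer coefficients let the solver cancel in an arbitrary commutative ring.
  open RingSolver ℤ.+-*-rawRing (fromCommutativeRing R) ι-homomorphism
    (λ i j → Maybe.map (reflexive ∘ ≡.cong ι) (dec⇒maybe (i ℤ.≟ j)))
    public using (solve; _:=_; _:+_; _:*_; _:-_; :-_; con)

-- Elementary symmetric functions, power sums and Newton's identities

module NewtonIdentities {a ℓ} (R : CommutativeRing a ℓ) where

  open CommutativeRing R hiding (zero)
  open Exp semiring using (_^_)
  open IntegerImage R
  open ≈-Reasoning setoid

  private
    _≋_ : ∀ {n} → Vec Carrier n → Vec Carrier n → Set _
    _≋_ = Pointwise _≈_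

  -- Coefficients are listed from the constant term upwards.
  horner : ∀ {n} → Carrier → Vec Carrier n → Carrier
  horner x []       = 0#
  horner x (c ∷ cs) = c + x * horner x cs

  horner-cong : ∀ {n x y} {cs ds : Vec Carrier n} → x ≈ y → cs ≋ ds →
                horner x cs ≈ horner y ds
  horner-cong x≈y []            = refl
  horner-cong x≈y (c≈d ∷ cs≋ds) = +-cong c≈d (*-cong x≈y (horner-cong x≈y cs≋ds))

  dot : ∀ {n} → Vec Carrier n → (ℕ → Carrier) → Carrier
  dot []       p = 0#
  dot (c ∷ cs) p = c * p 0 + dot cs (p ∘ suc)

  dot-cong : ∀ {n} {cs ds : Vec Carrier n} {p p′ : ℕ → Carrier} → cs ≋ ds →
             (∀ {i} → i < n → p i ≈ p′ i) → dot cs p ≈ dot ds p′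
  dot-cong []            p≈p′ = refl
  dot-cong (c≈d ∷ cs≋ds) p≈p′ =
    +-cong (*-cong c≈d (p≈p′ (s≤s z≤n))) (dot-cong cs≋ds (p≈p′ ∘ s≤s))

  dot-+ : ∀ {n} (cs : Vec Carrier n) (p p′ : ℕ → Carrier) →
          dot cs (λ i → p i + p′ i) ≈ dot cs p + dot cs p′
  dot-+ []       p p′ = sym (+-identityˡ 0#)
  dot-+ (c ∷ cs) p p′ = trans (+-congˡ (dot-+ cs (p ∘ suc) (p′ ∘ suc)))
    (solve 5 (λ c x y d d′ → c :* (x :+ y) :+ (d :+ d′) := (c :* x :+ d) :+ (c :* y :+ d′))
      refl c (p 0) (p′ 0) (dot cs (p ∘ suc)) (dot cs (p′ ∘ suc)))

  dot-0 : ∀ {n} (cs : Vec Carrier n) → dot cs (λ _ → 0#) ≈ 0#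
  dot-0 []       = refl
  dot-0 (c ∷ cs) = trans (+-cong (zeroʳ c) (dot-0 cs)) (+-identityˡ 0#)

  -- elementary ys n is (-1)ⁿ times the n-th elementary symmetric function of
  -- ys, that is, the coefficient of Tⁿ in ∏ (1 - y T).
  elementary : List Carrier → ℕ → Carrier
  elementary ys       zero    = 1#
  elementary []       (suc n) = 0#
  elementary (y ∷ ys) (suc n) = elementary ys (suc n) - y * elementary ys n

  powerSum : List Carrier → ℕ → Carrier
  powerSum []       i = 0#
  powerSum (y ∷ ys) i = y ^ i + powerSum ys i

  -- With the constant term first, `downFrom (elementary ys) n` is the coefficient vector of ∏ (X -
  -- y), times X to the power `n - length ys`, whenever `length ys ≤ n`.
  downFrom : (ℕ → Carrier) → ∀ n → Vec Carrier (suc n)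
  downFrom c zero    = c 0 ∷ []
  downFrom c (suc n) = c (suc n) ∷ downFrom c n

  elementary-long : ∀ ys {n} → length ys < n → elementary ys n ≈ 0#
  elementary-long []       (s≤s _)  = refl
  elementary-long (y ∷ ys) {suc n} (s≤s ys<n) = begin
    elementary ys (suc n) - y * elementary ys n
      ≈⟨ +-cong (elementary-long ys (ℕ.m<n⇒m<1+n ys<n)) (-‿cong (*-congˡ (elementary-long ys ys<n))) ⟩
    0# - y * 0#
      ≈⟨ solve 1 (λ y → con (+ 0) :- y :* con (+ 0) := con (+ 0)) refl y ⟩
    0# ∎

  -- The recursion of `elementary` holds entry by entry, except that the last entry, of index 0, is
  -- 1 for both lists; so the subtracted vector is shorter by one.
  dot-∷ : ∀ y ys m p →
    dot (downFrom (elementary (y ∷ ys)) (suc m)) p ≈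
    dot (downFrom (elementary ys) (suc m)) p - y * dot (downFrom (elementary ys) m) p
  dot-∷ y ys zero p =
    solve 4 (λ y e p₀ p₁ →
        (e :- y :* con (+ 1)) :* p₀ :+ (con (+ 1) :* p₁ :+ con (+ 0)) :=
        e :* p₀ :+ (con (+ 1) :* p₁ :+ con (+ 0)) :- y :* (con (+ 1) :* p₀ :+ con (+ 0)))
      refl y (elementary ys 1) (p 0) (p 1)
  dot-∷ y ys (suc m) p = trans (+-congˡ (dot-∷ y ys m (p ∘ suc)))
    (solve 6 (λ y e e′ p₀ d d′ →
        (e :- y :* e′) :* p₀ :+ (d :- y :* d′) := e :* p₀ :+ d :- y :* (e′ :* p₀ :+ d′))
      refl y (elementary ys (suc (suc m))) (elementary ys (suc m)) (p 0)
      (dot (downFrom (elementary ys) (suc m)) (p ∘ suc)) (dot (downFrom (elementary ys) m) (p ∘ suc)))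

  -- In terms of generating functions, the geometric series is `p 0` / (1 - y T) and cancels the
  -- factor 1 - y T that `y` contributes to the product.
  dot-geometric : ∀ y ys n p → (∀ i → p (suc i) ≈ y * p i) →
    dot (downFrom (elementary (y ∷ ys)) n) p ≈ p 0 * elementary ys n
  dot-geometric y ys zero p geom =
    solve 1 (λ x → con (+ 1) :* x :+ con (+ 0) := x :* con (+ 1)) refl (p 0)
  dot-geometric y ys (suc n) p geom = begin
    (e - y * e′) * p 0 + dot (downFrom (elementary (y ∷ ys)) n) (p ∘ suc)
      ≈⟨ +-congˡ (dot-geometric y ys n (p ∘ suc) (geom ∘ suc)) ⟩
    (e - y * e′) * p 0 + p 1 * e′
      ≈⟨ +-congˡ (*-congʳ (geom 0)) ⟩
    (e - y * e′) * p 0 + y * p 0 * e′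
      ≈⟨ solve 4 (λ e e′ y p₀ → (e :- y :* e′) :* p₀ :+ y :* p₀ :* e′ := p₀ :* e) refl e e′ y (p 0) ⟩
    p 0 * e ∎
    where
    e  = elementary ys (suc n)
    e′ = elementary ys n

  -- Induction on the list. The powers of the new entry `y` are summed by `dot-geometric`; what
  -- remains is the identity for `ys` at `n` minus `y` times the one at `n - 1`. No division occurs,
  -- so this holds in every commutative ring and for every `n`.
  newton-identity : ∀ ys n →
    suc n · 1# * elementary ys (suc n) + dot (downFrom (elementary ys) n) (powerSum ys ∘ suc) ≈ 0#
  newton-identity [] n = trans (+-cong (zeroʳ _) (dot-0 (downFrom (elementary []) n))) (+-identityˡ 0#)
  newton-identity (y ∷ ys) n = begin
    suc n · 1# * (e - y * e′) + dot (downFrom (elementary (y ∷ ys)) n) (powerSum (y ∷ ys) ∘ suc)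
      ≈⟨ +-cong (*-congʳ (1+× n 1#))
                (trans (dot-+ (downFrom (elementary (y ∷ ys)) n) ((y ^_) ∘ suc) (powerSum ys ∘ suc))
                       (+-congʳ (dot-geometric y ys n ((y ^_) ∘ suc) (λ _ → refl)))) ⟩
    (1# + n · 1#) * (e - y * e′) + (y * 1# * e′ + dot (downFrom (elementary (y ∷ ys)) n) (powerSum ys ∘ suc))
      ≈⟨ rest n ⟩
    0# ∎
    where
    e  = elementary ys (suc n)
    e′ = elementary ys n
    rest : ∀ n → let e = elementary ys (suc n); e′ = elementary ys n in
      (1# + n · 1#) * (e - y * e′) +
      (y * 1# * e′ + dot (downFrom (elementary (y ∷ ys)) n) (powerSum ys ∘ suc)) ≈ 0#
    -- There is no identity at `n - 1` here; the two terms in `y` cancel directly.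
    rest zero = trans
      (solve 3 (λ y e d →
          (con (+ 1) :+ con (+ 0)) :* (e :- y :* con (+ 1)) :+ (y :* con (+ 1) :* con (+ 1) :+ d) :=
          con (+ 1) :* e :+ d)
        refl y (elementary ys 1) (dot (downFrom (elementary ys) 0) (powerSum ys ∘ suc)))
      (newton-identity ys 0)
    rest (suc m) = begin
      (1# + suc m · 1#) * (e₂ - y * e₁) + (y * 1# * e₁ + dot (downFrom (elementary (y ∷ ys)) (suc m)) p)
        ≈⟨ +-congˡ (+-congˡ (dot-∷ y ys m p)) ⟩
      (1# + suc m · 1#) * (e₂ - y * e₁) + (y * 1# * e₁ + (d₁ - y * d₀))
        ≈⟨ solve 6 (λ k y e₂ e₁ d₁ d₀ →
             (con (+ 1) :+ k) :* (e₂ :- y :* e₁) :+ (y :* con (+ 1) :* e₁ :+ (d₁ :- y :* d₀)) :=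
             ((con (+ 1) :+ k) :* e₂ :+ d₁) :- y :* (k :* e₁ :+ d₀))
             refl (suc m · 1#) y e₂ e₁ d₁ d₀ ⟩
      ((1# + suc m · 1#) * e₂ + d₁) - y * (suc m · 1# * e₁ + d₀)
        ≈⟨ +-cong (trans (+-congʳ (*-congʳ (sym (1+× (suc m) 1#)))) (newton-identity ys (suc m)))
                  (-‿cong (*-congˡ (newton-identity ys m))) ⟩
      0# - y * 0#
        ≈⟨ solve 1 (λ y → con (+ 0) :- y :* con (+ 0) := con (+ 0)) refl y ⟩
      0# ∎
      where
      p  = powerSum ys ∘ suc
      e₂ = elementary ys (suc (suc m))
      e₁ = elementary ys (suc m)
      d₁ = dot (downFrom (elementary ys) (suc m)) p
      d₀ = dot (downFrom (elementary ys) m) p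

  -- Newton's recursion, where r n is to be the inverse of n and p i stands
  -- for the power sum of exponent i + 1.
  newton : (r p : ℕ → Carrier) → ∀ n → Vec Carrier (suc n)
  newton r p zero    = 1# ∷ []
  newton r p (suc n) = - (r (suc n) * dot (newton r p n) p) ∷ newton r p n

  -- Newton's identity can be solved for the elementary function of index `suc n` once `suc n` is
  -- invertible, so the first `k` power sums determine the first `k` elementary functions if 1, ...,
  -- `k` are invertible.
  newton-elementary : ∀ {r p : ℕ → Carrier} {k} ys →
    (∀ {i} → i < k → r (suc i) * suc i · 1# ≈ 1#) →
    (∀ {i} → i < k → p i ≈ powerSum ys (suc i)) →
    ∀ {n} → n ≤ k → newton r p n ≋ downFrom (elementary ys) n
  newton-elementary ys r-inv p≈ {zero} n≤k = refl ∷ []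
  newton-elementary {r} {p} ys r-inv p≈ {suc n} n<k = head≈ ∷ ih
    where
    ih = newton-elementary {r} {p} ys r-inv p≈ (ℕ.<⇒≤ n<k)
    s = suc n · 1#
    e = elementary ys (suc n)
    d = dot (downFrom (elementary ys) n) (powerSum ys ∘ suc)
    head≈ : - (r (suc n) * dot (newton r p n) p) ≈ e
    head≈ = begin
      - (r (suc n) * dot (newton r p n) p)
        ≈⟨ -‿cong (*-congˡ (dot-cong ih (λ i≤n → p≈ (ℕ.<-≤-trans i≤n n<k)))) ⟩
      - (r (suc n) * d)
        -- Adding and subtracting `r s e` exposes the left side of Newton's identity.
        ≈⟨ solve 4 (λ r s e d → :- (r :* d) := r :* s :* e :- r :* (s :* e :+ d)) refl (r (suc n)) s e d ⟩
      r (suc n) * s * e - r (suc n) * (s * e + d)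
        ≈⟨ +-cong (*-congʳ (r-inv n<k)) (-‿cong (*-congˡ (newton-identity ys n))) ⟩
      1# * e - r (suc n) * 0#
        ≈⟨ solve 2 (λ r e → con (+ 1) :* e :- r :* con (+ 0) := e) refl (r (suc n)) e ⟩
      e ∎

  horner-∷ : ∀ x y ys n →
    horner x (downFrom (elementary (y ∷ ys)) (suc n)) ≈
    horner x (downFrom (elementary ys) (suc n)) - y * horner x (downFrom (elementary ys) n)
  horner-∷ x y ys zero =
    solve 3 (λ x y e →
        e :- y :* con (+ 1) :+ x :* (con (+ 1) :+ x :* con (+ 0)) :=
        e :+ x :* (con (+ 1) :+ x :* con (+ 0)) :- y :* (con (+ 1) :+ x :* con (+ 0)))
      refl x y (elementary ys 1)
  horner-∷ x y ys (suc n) = trans (+-congˡ (*-congˡ (horner-∷ x y ys n)))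
    (solve 6 (λ x y e e′ h h′ →
        e :- y :* e′ :+ x :* (h :- y :* h′) := e :+ x :* h :- y :* (e′ :+ x :* h′))
      refl x y (elementary ys (suc (suc n))) (elementary ys (suc n))
      (horner x (downFrom (elementary ys) (suc n))) (horner x (downFrom (elementary ys) n)))

  -- The polynomial is a multiple of ∏ (X - y). If `x` is the head of the list, the recursion
  -- `horner-∷` leaves only a coefficient beyond the length of the tail, which is 0; if `x` is in
  -- the tail, both parts of the recursion vanish.
  horner-elementary-root : ∀ {x n} ys → length ys ≤ n → Any (x ≈_) ys →
    horner x (downFrom (elementary ys) n) ≈ 0#
  horner-elementary-root {x} {suc n} (y ∷ ys) (s≤s ys≤n) (here x≈y) = begin
    horner x (downFrom (elementary (y ∷ ys)) (suc n))  ≈⟨ horner-∷ x y ys n ⟩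
    elementary ys (suc n) + x * h - y * h
      ≈⟨ +-cong (+-cong (elementary-long ys (s≤s ys≤n)) (*-congʳ x≈y)) refl ⟩
    0# + y * h - y * h
      ≈⟨ solve 2 (λ y h → con (+ 0) :+ y :* h :- y :* h := con (+ 0)) refl y h ⟩
    0# ∎
    where h = horner x (downFrom (elementary ys) n)
  horner-elementary-root {x} {suc n} (y ∷ ys) (s≤s ys≤n) (there x∈ys) = begin
    horner x (downFrom (elementary (y ∷ ys)) (suc n))  ≈⟨ horner-∷ x y ys n ⟩
    horner x (downFrom (elementary ys) (suc n)) - y * horner x (downFrom (elementary ys) n)
      ≈⟨ +-cong (horner-elementary-root ys (ℕ.m≤n⇒m≤1+n ys≤n) x∈ys)
                (-‿cong (*-congˡ (horner-elementary-root ys ys≤n x∈ys))) ⟩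
    0# - y * 0#
      ≈⟨ solve 1 (λ y → con (+ 0) :- y :* con (+ 0) := con (+ 0)) refl y ⟩
    0# ∎

  horner-elementary-[] : ∀ x n → horner x (downFrom (elementary []) n) ≈ x ^ n
  horner-elementary-[] x zero    = trans (+-congˡ (zeroʳ x)) (+-identityʳ 1#)
  horner-elementary-[] x (suc n) = trans (+-identityˡ _) (*-congˡ (horner-elementary-[] x n))

-- Inverses and roots of polynomials over a finite field

module FieldProperties {q a b} (F : FiniteField q a b) where

  open FiniteField F hiding (zero)
  open GroupProperties +-group using (x∙y⁻¹≈ε⇒x≈y; identityʳ-unique)
  open Exp semiring using (_^_; ^-congˡ)
  open CommutativeExp commutativeSemiring using (^-distrib-*)
  open Sum semiring using (sum; sum-cong-≋; *-distribˡ-sum; sum-replicate; sum-replicate-zero)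
  open CommutativeSum +-commutativeMonoid using (sum-remove; sum-permute; ∑-distrib-+)
  open MonoidMult +-monoid using (×ᵤ≈×)
  open IntegerImage commutativeRing
  open NewtonIdentities commutativeRing using (horner; powerSum)
  open ≈-Reasoning setoid

  -- Abstract, so that a case split on _≟_ does not also split inside recip.
  abstract
    recip : Carrier → Carrier
    recip x with x ≟ 0#
    ... | yes _  = 0#
    ... | no x≉0 = proj₁ (inverse x x≉0)

    recip-inverse : ∀ {x} → ¬ x ≈ 0# → recip x * x ≈ 1#
    recip-inverse {x} x≉0 with x ≟ 0#
    ... | yes x≈0  = contradiction x≈0 x≉0
    ... | no  x≉0′ = trans (*-comm _ x) (proj₂ (inverse x x≉0′))

  x*y≈0⇒y≈0 : ∀ {x y} → ¬ x ≈ 0# → x * y ≈ 0# → y ≈ 0#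
  x*y≈0⇒y≈0 {x} {y} x≉0 xy≈0 = begin
    y                 ≈⟨ *-identityˡ y ⟨
    1# * y            ≈⟨ *-congʳ (recip-inverse x≉0) ⟨
    recip x * x * y   ≈⟨ *-assoc _ x y ⟩
    recip x * (x * y) ≈⟨ *-congˡ xy≈0 ⟩
    recip x * 0#      ≈⟨ zeroʳ _ ⟩
    0#                ∎

  -- horner x cs - horner a cs = (x - a) * horner x (quotient a cs)
  quotient : ∀ {n} → Carrier → Vec Carrier (suc n) → Vec Carrier n
  quotient {zero}  a cs       = []
  quotient {suc n} a (c ∷ cs) = horner a cs ∷ quotient a cs

  horner-quotient : ∀ {n} a x (cs : Vec Carrier (suc n)) →
    horner x cs ≈ horner a cs + (x - a) * horner x (quotient a cs)
  horner-quotient {zero} a x (c ∷ []) =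
    solve 3 (λ a x c → c :+ x :* con (+ 0) := c :+ a :* con (+ 0) :+ (x :- a) :* con (+ 0)) refl a x c
  horner-quotient {suc n} a x (c ∷ cs) = trans (+-congˡ (*-congˡ (horner-quotient a x cs)))
    (solve 5 (λ a x c h k →
        c :+ x :* (h :+ (x :- a) :* k) := c :+ a :* h :+ (x :- a) :* (h :+ x :* k))
      refl a x c (horner a cs) (horner x (quotient a cs)))

  last-quotient : ∀ {n} a (cs : Vec Carrier (suc (suc n))) →
                  Vec.last (quotient a cs) ≈ Vec.last cs
  last-quotient {zero}  a (c ∷ d ∷ [])    = trans (+-congˡ (zeroʳ a)) (+-identityʳ d)
  last-quotient {suc n} a (c ∷ d ∷ e ∷ cs) = last-quotient a (d ∷ e ∷ cs)

  -- There is one root more than the degree allows. Dividing by X - `x zero` keeps the leading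
  -- coefficient and, by injectivity of `x`, the other roots. Tracking the leading coefficient
  -- suffices to refute the vanishing of a monic polynomial.
  leading-coefficient-zero : ∀ {n} (cs : Vec Carrier (suc n)) (x : Fin (suc n) → Carrier) →
    (∀ {i j} → x i ≈ x j → i ≡ j) → (∀ i → horner (x i) cs ≈ 0#) → Vec.last cs ≈ 0#
  leading-coefficient-zero {zero} (c ∷ []) x inj root = begin
    c                    ≈⟨ +-identityʳ c ⟨
    c + 0#               ≈⟨ +-congˡ (zeroʳ (x zero)) ⟨
    c + x zero * 0#      ≈⟨ root zero ⟩
    0#                   ∎
  leading-coefficient-zero {suc n} cs x inj root =
    trans (sym (last-quotient (x zero) cs))
          (leading-coefficient-zero (quotient (x zero) cs) (x ∘ suc) (Fin.suc-injective ∘ inj) root′)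
    where
    root′ : ∀ i → horner (x (suc i)) (quotient (x zero) cs) ≈ 0#
    root′ i = x*y≈0⇒y≈0 {x (suc i) - x zero}
      (λ x-x≈0 → Fin.0≢1+n (inj (sym (x∙y⁻¹≈ε⇒x≈y _ _ x-x≈0))))
      (begin
        (x (suc i) - x zero) * h         ≈⟨ +-identityˡ _ ⟨
        0# + (x (suc i) - x zero) * h    ≈⟨ +-congʳ (root zero) ⟨
        horner (x zero) cs + (x (suc i) - x zero) * h ≈⟨ horner-quotient _ _ cs ⟨
        horner (x (suc i)) cs            ≈⟨ root (suc i) ⟩
        0# ∎)
      where h = horner (x (suc i)) (quotient (x zero) cs)

  -- Sums over all field elements

  element : Fin q → Carrier
  element = Inverse.from size

  index : Carrier → Fin q
  index = Inverse.to size

  element-index : ∀ x → element (index x) ≈ x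
  element-index = Inverse.strictlyInverseʳ size

  element-injective : ∀ {i j} → element i ≈ element j → i ≡ j
  element-injective {i} {j} eq = ≡.trans (≡.sym (Inverse.strictlyInverseˡ size i))
    (≡.trans (Inverse.to-cong size eq) (Inverse.strictlyInverseˡ size j))

  -- A bijection of the field becomes a permutation of `Fin q` by passing through `index` and
  -- `element`. The round trip returns an element only up to `≈`, whence the congruence hypotheses.
  sum-bijection : (f φ ψ : Carrier → Carrier) → (∀ {x y} → x ≈ y → f x ≈ f y) →
    (∀ {x y} → x ≈ y → φ x ≈ φ y) → (∀ {x y} → x ≈ y → ψ x ≈ ψ y) →
    (∀ x → φ (ψ x) ≈ x) → (∀ x → ψ (φ x) ≈ x) →
    sum (f ∘ element) ≈ sum (f ∘ φ ∘ element)
  sum-bijection f φ ψ f-cong φ-cong ψ-cong φψ ψφ =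
    trans (sum-permute (f ∘ element) π) (sum-cong-≋ (λ i → f-cong (element-index (φ (element i)))))
    where
    π : Permutation q q
    π = permutation (index ∘ φ ∘ element) (index ∘ ψ ∘ element)
      (λ i → element-injective (trans (element-index _) (trans (φ-cong (element-index _)) (φψ _))))
      (λ i → element-injective (trans (element-index _) (trans (ψ-cong (element-index _)) (ψφ _))))

  sum-zero : ∀ {n} {f : Fin n → Carrier} → (∀ i → f i ≈ 0#) → sum f ≈ 0#
  sum-zero {n} f≈0 = trans (sum-cong-≋ f≈0) (sum-replicate-zero n)

  sum-single : ∀ {n} {f : Fin n → Carrier} i → (∀ j → j ≢ i → f j ≈ 0#) → sum f ≈ f i
  sum-single {suc n} {f} i f≈0 = begin
    sum f                               ≈⟨ sum-remove f ⟩
    f i + sum (λ j → f (punchIn i j))   ≈⟨ +-congˡ (sum-zero (λ j → f≈0 _ (Fin.punchInᵢ≢i i j))) ⟩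
    f i + 0#                            ≈⟨ +-identityʳ _ ⟩
    f i                                 ∎

  -- Translation by 1 permutes the field, so adding 1 to each of the `q` summands does not change
  -- the sum of all elements.
  q·1≈0 : q · 1# ≈ 0#
  q·1≈0 = identityʳ-unique (sum element) (q · 1#) (sym (begin
    sum element                             ≈⟨ sum-bijection id (_+ 1#) (_- 1#) id +-congʳ +-congʳ
                                                 (λ x → solve 1 (λ x → x :- con (+ 1) :+ con (+ 1) := x) refl x)
                                                 (λ x → solve 1 (λ x → x :+ con (+ 1) :- con (+ 1) := x) refl x) ⟩
    sum (λ i → element i + 1#)              ≈⟨ ∑-distrib-+ element (λ _ → 1#) ⟩
    sum element + sum {q} (λ _ → 1#)        ≈⟨ +-congˡ (trans (sum-replicate q) (×ᵤ≈× q 1#)) ⟩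
    sum element + q · 1#                    ∎))

  -- A field has no zero divisors, so one of the factors `p · 1#` vanishes; the empty product is 1.
  p^h·1≈0⇒p·1≈0 : ∀ p h → (p ℕ.^ h) · 1# ≈ 0# → p · 1# ≈ 0#
  p^h·1≈0⇒p·1≈0 p zero 1≈0 = contradiction 1≈0 1≉0
  p^h·1≈0⇒p·1≈0 p (suc h) eq with (p · 1#) ≟ 0#
  ... | yes p≈0 = p≈0
  ... | no  p≉0 = p^h·1≈0⇒p·1≈0 p h (x*y≈0⇒y≈0 p≉0 (trans (sym (×1-homo-* p (p ℕ.^ h))) eq))

  -- Arithmetic in characteristic p

  module Characteristic {p} (p-prime : Prime p) (p·1≈0 : p · 1# ≈ 0#) where

    multiple-zero : ∀ n → (n ℕ.* p) · 1# ≈ 0#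
    multiple-zero n = trans (×1-homo-* n p) (trans (*-congˡ p·1≈0) (zeroʳ _))

    -- As `n` is coprime to `p`, Bézout makes a multiple of one exceed a multiple of the other by 1;
    -- if both had image 0, then 1 would be 0.
    n·1≉0 : ∀ {n} → .{{ℕ.NonZero n}} → n < p → ¬ n · 1# ≈ 0#
    n·1≉0 {n} n<p n≈0 with Coprimality.coprime-Bézout (Coprimality.prime⇒coprime p-prime n<p)
    ... | GCD.Bézout.+- x y eq = 1≉0 (begin
      1#                       ≈⟨ +-identityʳ 1# ⟨
      1# + 0#                  ≈⟨ +-congˡ (trans (×1-homo-* y n) (trans (*-congˡ n≈0) (zeroʳ _))) ⟨
      1# + (y ℕ.* n) · 1#      ≈⟨ 1+× (y ℕ.* n) 1# ⟨
      suc (y ℕ.* n) · 1#       ≡⟨ ≡.cong (_· 1#) eq ⟩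
      (x ℕ.* p) · 1#           ≈⟨ multiple-zero x ⟩
      0#                       ∎)
    ... | GCD.Bézout.-+ x y eq = 1≉0 (begin
      1#                       ≈⟨ +-identityʳ 1# ⟨
      1# + 0#                  ≈⟨ +-congˡ (multiple-zero x) ⟨
      1# + (x ℕ.* p) · 1#      ≈⟨ 1+× (x ℕ.* p) 1# ⟨
      suc (x ℕ.* p) · 1#       ≡⟨ ≡.cong (_· 1#) eq ⟩
      (y ℕ.* n) · 1#           ≈⟨ trans (×1-homo-* y n) (trans (*-congˡ n≈0) (zeroʳ _)) ⟩
      0#                       ∎)

    -- Turns the congruence modulo `p` that defines `C₁` into an equality in the field.
    p∣i-j⇒ιi≈ιj : ∀ i j → + p ℤ.∣ i ℤ.- j → ι i ≈ ι j
    p∣i-j⇒ιi≈ιj i j (ℤ.divides k eq) = x∙y⁻¹≈ε⇒x≈y _ _ (begin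
      ι i - ι j            ≈⟨ +-congˡ (ι-neg j) ⟨
      ι i + ι (ℤ.- j)      ≈⟨ ι-+ i (ℤ.- j) ⟨
      ι (i ℤ.- j)          ≡⟨ ≡.cong ι eq ⟩
      ι (k ℤ.* + p)        ≈⟨ ι-* k (+ p) ⟩
      ι k * p · 1#         ≈⟨ *-congˡ p·1≈0 ⟩
      ι k * 0#             ≈⟨ zeroʳ _ ⟩
      0#                   ∎)

  -- Power sums of the whole field

  private
    X^_ : ∀ n → Vec Carrier (suc n)
    X^ zero  = 1# ∷ []
    X^ suc n = 0# ∷ X^ n

    horner-X^ : ∀ x n → horner x (X^ n) ≈ x ^ n
    horner-X^ x zero    = trans (+-congˡ (zeroʳ x)) (+-identityʳ 1#)
    horner-X^ x (suc n) = trans (+-identityˡ _) (*-congˡ (horner-X^ x n))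

    last-X^ : ∀ n → Vec.last (X^ n) ≡ 1#
    last-X^ zero          = ≡.refl
    last-X^ (suc zero)    = ≡.refl
    last-X^ (suc (suc n)) = last-X^ (suc n)

  -- Otherwise `n + 3` distinct elements would be roots of the monic polynomial X^(n+2) - X. An
  -- element `x` with `x * x ^ suc n` different from `x` is nonzero and has `x ^ suc n` different
  -- from 1; both facts are wanted in `sum-of-powers`.
  ∃-nonfixed-power : ∀ n → 3 ℕ.+ n ≤ q → ∃ λ i → ¬ element i * element i ^ suc n ≈ element i
  ∃-nonfixed-power n n+3≤q = Fin.¬∀⟶∃¬ q _ (λ i → (element i * element i ^ suc n) ≟ element i)
    λ fixed → 1≉0 (trans (reflexive (≡.sym (last-cs n))) (leading-coefficient-zero (cs n)
      (λ i → element (inject≤ i n+3≤q))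
      (Fin.inject≤-injective n+3≤q n+3≤q _ _ ∘ element-injective)
      (λ i → root (element (inject≤ i n+3≤q)) (fixed (inject≤ i n+3≤q)))))
    where
    cs : ∀ n → Vec Carrier (3 ℕ.+ n)
    cs n = 0# ∷ - 1# ∷ X^ n
    last-cs : ∀ n → Vec.last (cs n) ≡ 1#
    last-cs zero = ≡.refl
    last-cs (suc n) = last-X^ (suc n)
    root : ∀ x → x * x ^ suc n ≈ x → horner x (cs n) ≈ 0#
    root x eq = begin
      0# + x * (- 1# + x * horner x (X^ n))  ≈⟨ +-congˡ (*-congˡ (+-congˡ (*-congˡ (horner-X^ x n)))) ⟩
      0# + x * (- 1# + x ^ suc n)
        ≈⟨ solve 2 (λ x y → con (+ 0) :+ x :* (:- con (+ 1) :+ y) := x :* y :- x) refl x (x ^ suc n) ⟩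
      x * x ^ suc n - x                      ≈⟨ +-congʳ eq ⟩
      x - x                                  ≈⟨ -‿inverseʳ x ⟩
      0#                                     ∎

  -- Multiplication by a nonzero `g` permutes the field.
  sum-scaled-powers : ∀ {g} → ¬ g ≈ 0# → ∀ n →
    sum (λ i → element i ^ n) ≈ g ^ n * sum (λ i → element i ^ n)
  sum-scaled-powers {g} g≉0 n = begin
    sum (λ i → element i ^ n)
      ≈⟨ sum-bijection (_^ n) (g *_) (recip g *_) (^-congˡ n) *-congˡ *-congˡ
           (cancel (trans (*-comm g _) (recip-inverse g≉0))) (cancel (recip-inverse g≉0)) ⟩
    sum (λ i → (g * element i) ^ n)        ≈⟨ sum-cong-≋ (λ i → ^-distrib-* g (element i) n) ⟩
    sum (λ i → g ^ n * element i ^ n)      ≈⟨ *-distribˡ-sum (g ^ n) (λ i → element i ^ n) ⟨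
    g ^ n * sum (λ i → element i ^ n)      ∎
    where
    cancel : ∀ {x y} → x * y ≈ 1# → ∀ z → x * (y * z) ≈ z
    cancel xy≈1 z = trans (sym (*-assoc _ _ z)) (trans (*-congʳ xy≈1) (*-identityˡ z))

  private
    x≈cx⇒x≈0 : ∀ {c x} → ¬ c ≈ 1# → x ≈ c * x → x ≈ 0#
    x≈cx⇒x≈0 {c} {x} c≉1 x≈cx = x*y≈0⇒y≈0 {1# - c}
      (λ 1-c≈0 → c≉1 (sym (x∙y⁻¹≈ε⇒x≈y _ _ 1-c≈0)))
      (begin
        (1# - c) * x   ≈⟨ solve 2 (λ c x → (con (+ 1) :- c) :* x := x :- c :* x) refl c x ⟩
        x - c * x      ≈⟨ +-congˡ (-‿cong x≈cx) ⟨
        x - x          ≈⟨ -‿inverseʳ x ⟩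
        0#             ∎)

  -- Scaling by a suitable `g` multiplies the sum by a factor other than 1 and yet preserves it. The
  -- exponents covered are 1, ..., `q - 2`.
  sum-of-powers : ∀ n → 3 ℕ.+ n ≤ q → sum (λ i → element i ^ suc n) ≈ 0#
  sum-of-powers n n+3≤q =
    let i , nonfixed = ∃-nonfixed-power n n+3≤q in
    x≈cx⇒x≈0
      (λ gⁿ≈1 → nonfixed (trans (*-congˡ gⁿ≈1) (*-identityʳ (element i))))
      (sum-scaled-powers (λ g≈0 → nonfixed (trans (*-congʳ g≈0) (trans (zeroˡ _) (sym g≈0)))) (suc n))

  powerSum-filter : ∀ {m n p} {A : Set m} {P : A → Set p} (P? : Decidable P)
    (f : A → Carrier) (h : Fin n → A) k →
    powerSum (List.map f (List.filter P? (List.tabulate h))) k ≈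
    sum (λ i → if does (P? (h i)) then f (h i) ^ k else 0#)
  powerSum-filter {n = zero}  P? f h k = refl
  powerSum-filter {n = suc n} P? f h k with does (P? (h zero))
  ... | true  = +-congˡ (powerSum-filter P? f (h ∘ suc) k)
  ... | false = trans (powerSum-filter P? f (h ∘ suc) k) (sym (+-identityˡ _))

-- Functions given by homogeneous polynomials

module Forms {q a b} (F : FiniteField q a b) where

  open FiniteField F hiding (zero)
  open PG2 F
  open Exp semiring using (_^_; ^-homo-*)
  open Sum semiring using (sum)
  open RingProperties ring using (-1*x≈-x)
  open IntegerImage commutativeRing using (solve; _:=_; _:+_; _:*_)
  open NewtonIdentities commutativeRing using (horner; dot; newton)
  open ≈-Reasoning setoid

  private
    variable
      m n : ℕ
      φ ψ : Vector Carrier 3 → Carrier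

  monomial : Monomial → Vector Carrier 3 → Carrier
  monomial (i , j , k) v = v 0F ^ i * v 1F ^ j * v 2F ^ k

  -- The degree is imposed on every term, not on collected coefficients, so that closure under sums
  -- and products is a matter of lists. The zero function is a form of every degree.
  IsForm : ℕ → (Vector Carrier 3 → Carrier) → Set _
  IsForm n φ = ∃ λ f → All (λ t → degree (proj₂ t) ≡ n) f × (∀ v → evaluate f v ≈ φ v)

  form-cong : (∀ v → φ v ≈ ψ v) → IsForm n φ → IsForm n ψ
  form-cong φ≈ψ (f , deg , eval) = f , deg , λ v → trans (eval v) (φ≈ψ v)

  form-0 : IsForm n (λ _ → 0#)
  form-0 = [] , [] , λ _ → refl

  form-const : ∀ c → IsForm 0 (λ _ → c)
  form-const c = (c , 0 , 0 , 0) ∷ [] , ≡.refl ∷ [] , λ v →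
    trans (+-identityʳ _) (trans (*-congˡ (trans (*-identityʳ _) (*-identityʳ 1#))) (*-identityʳ c))

  form-coordinate : ∀ i → IsForm 1 (λ v → v i)
  form-coordinate 0F = (1# , 1 , 0 , 0) ∷ [] , ≡.refl ∷ [] , λ v →
    trans (+-identityʳ _) (trans (*-identityˡ _) (trans (*-identityʳ _) (trans (*-identityʳ _) (*-identityʳ _))))
  form-coordinate 1F = (1# , 0 , 1 , 0) ∷ [] , ≡.refl ∷ [] , λ v →
    trans (+-identityʳ _) (trans (*-identityˡ _) (trans (*-identityʳ _) (trans (*-identityˡ _) (*-identityʳ _))))
  form-coordinate 2F = (1# , 0 , 0 , 1) ∷ [] , ≡.refl ∷ [] , λ v →
    trans (+-identityʳ _) (trans (*-identityˡ _)
      (trans (*-congʳ (*-identityˡ 1#)) (trans (*-identityˡ _) (*-identityʳ _))))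

  evaluate-++ : ∀ f g v → evaluate (f ++ g) v ≈ evaluate f v + evaluate g v
  evaluate-++ []      g v = sym (+-identityˡ _)
  evaluate-++ (t ∷ f) g v = trans (+-congˡ (evaluate-++ f g v)) (sym (+-assoc _ _ _))

  form-+ : IsForm n φ → IsForm n ψ → IsForm n (λ v → φ v + ψ v)
  form-+ (f , f-deg , f≈φ) (g , g-deg , g≈ψ) =
    f ++ g , All.++⁺ f-deg g-deg , λ v → trans (evaluate-++ f g v) (+-cong (f≈φ v) (g≈ψ v))

  scaleByTerm : Carrier × Monomial → Polynomial → Polynomial
  scaleByTerm (c , i , j , k) =
    List.map λ (c′ , i′ , j′ , k′) → c * c′ , i ℕ.+ i′ , j ℕ.+ j′ , k ℕ.+ k′

  evaluate-scaleByTerm : ∀ c e f v →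
    evaluate (scaleByTerm (c , e) f) v ≈ c * monomial e v * evaluate f v
  evaluate-scaleByTerm c e [] v = sym (zeroʳ _)
  evaluate-scaleByTerm c e@(i , j , k) ((c′ , e′@(i′ , j′ , k′)) ∷ f) v = begin
    c * c′ * (x ^ (i ℕ.+ i′) * y ^ (j ℕ.+ j′) * z ^ (k ℕ.+ k′)) + evaluate (scaleByTerm (c , e) f) v
      ≈⟨ +-cong (*-congˡ (*-cong (*-cong (^-homo-* x i i′) (^-homo-* y j j′)) (^-homo-* z k k′)))
                (evaluate-scaleByTerm c e f v) ⟩
    c * c′ * ((x ^ i * x ^ i′) * (y ^ j * y ^ j′) * (z ^ k * z ^ k′)) + c * (x ^ i * y ^ j * z ^ k) * evaluate f v
      ≈⟨ solve 9 (λ c c′ x x′ y y′ z z′ f →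
           c :* c′ :* ((x :* x′) :* (y :* y′) :* (z :* z′)) :+ c :* (x :* y :* z) :* f :=
           c :* (x :* y :* z) :* (c′ :* (x′ :* y′ :* z′) :+ f))
           refl c c′ (x ^ i) (x ^ i′) (y ^ j) (y ^ j′) (z ^ k) (z ^ k′) (evaluate f v) ⟩
    c * (x ^ i * y ^ j * z ^ k) * (c′ * (x ^ i′ * y ^ j′ * z ^ k′) + evaluate f v) ∎
    where
    x = v 0F
    y = v 1F
    z = v 2F

  degree-scaleByTerm : ∀ t f → degree (proj₂ t) ≡ m → All (λ t → degree (proj₂ t) ≡ n) f →
    All (λ t → degree (proj₂ t) ≡ m ℕ.+ n) (scaleByTerm t f)
  degree-scaleByTerm t [] deg-t [] = []
  degree-scaleByTerm t@(_ , i , j , k) ((_ , i′ , j′ , k′) ∷ f) ≡.refl (≡.refl ∷ deg-f) =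
    lemma i j k i′ j′ k′ ∷ degree-scaleByTerm t f ≡.refl deg-f
    where
    lemma : ∀ i j k i′ j′ k′ →
      i ℕ.+ i′ ℕ.+ (j ℕ.+ j′) ℕ.+ (k ℕ.+ k′) ≡ i ℕ.+ j ℕ.+ k ℕ.+ (i′ ℕ.+ j′ ℕ.+ k′)
    lemma = solve-∀

  multiply : Polynomial → Polynomial → Polynomial
  multiply f g = List.concatMap (λ t → scaleByTerm t g) f

  evaluate-multiply : ∀ f g v → evaluate (multiply f g) v ≈ evaluate f v * evaluate g v
  evaluate-multiply []            g v = sym (zeroˡ _)
  evaluate-multiply ((c , e) ∷ f) g v = begin
    evaluate (scaleByTerm (c , e) g ++ multiply f g) v
      ≈⟨ evaluate-++ (scaleByTerm (c , e) g) (multiply f g) v ⟩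
    evaluate (scaleByTerm (c , e) g) v + evaluate (multiply f g) v
      ≈⟨ +-cong (evaluate-scaleByTerm c e g v) (evaluate-multiply f g v) ⟩
    c * monomial e v * evaluate g v + evaluate f v * evaluate g v
      ≈⟨ distribʳ _ _ _ ⟨
    (c * monomial e v + evaluate f v) * evaluate g v ∎

  degree-multiply : ∀ {f g} → All (λ t → degree (proj₂ t) ≡ m) f → All (λ t → degree (proj₂ t) ≡ n) g →
    All (λ t → degree (proj₂ t) ≡ m ℕ.+ n) (multiply f g)
  degree-multiply []                  g-deg = []
  degree-multiply {g = g} (t-deg ∷ f-deg) g-deg =
    All.++⁺ (degree-scaleByTerm _ g t-deg g-deg) (degree-multiply f-deg g-deg)

  form-* : IsForm m φ → IsForm n ψ → IsForm (m ℕ.+ n) (λ v → φ v * ψ v)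
  form-* (f , f-deg , f≈φ) (g , g-deg , g≈ψ) =
    multiply f g , degree-multiply f-deg g-deg ,
    λ v → trans (evaluate-multiply f g v) (*-cong (f≈φ v) (g≈ψ v))

  form-scale : ∀ c → IsForm n φ → IsForm n (λ v → c * φ v)
  form-scale c = form-* (form-const c)

  form-neg : IsForm n φ → IsForm n (λ v → - φ v)
  form-neg φ-form = form-cong (λ v → -1*x≈-x _) (form-scale (- 1#) φ-form)

  form-^ : ∀ n → IsForm 1 φ → IsForm n (λ v → φ v ^ n)
  form-^ zero    φ-form = form-const 1#
  form-^ (suc n) φ-form = form-* φ-form (form-^ n φ-form)

  form-sum : ∀ {m} {φ : Fin m → Vector Carrier 3 → Carrier} →
    (∀ i → IsForm n (φ i)) → IsForm n (λ v → sum (λ i → φ i v))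
  form-sum {m = zero}  φ-form = form-0
  form-sum {m = suc m} φ-form = form-+ (φ-form zero) (form-sum (φ-form ∘ suc))

  infixr 5 _∷_

  -- The entries of a vector of length `n` are forms of degrees `n - 1`, ..., 0, as Newton's
  -- recursion produces them.
  data DescendingForms : ∀ {n} → (Vector Carrier 3 → Vec Carrier n) → Set (a Level.⊔ b) where
    []  : DescendingForms (λ _ → [])
    _∷_ : ∀ {cs : Vector Carrier 3 → Vec Carrier n} →
          IsForm n φ → DescendingForms cs → DescendingForms (λ v → φ v ∷ cs v)

  form-horner : ∀ {cs : Vector Carrier 3 → Vec Carrier (suc n)} →
    IsForm 1 φ → DescendingForms cs → IsForm n (λ v → horner (φ v) (cs v))
  form-horner φ-form (c-form ∷ []) =
    form-cong (λ v → sym (trans (+-congˡ (zeroʳ _)) (+-identityʳ _))) c-form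
  form-horner φ-form (c-form ∷ cs-form@(_ ∷ _)) =
    form-+ c-form (form-* φ-form (form-horner φ-form cs-form))

  -- Degrees fall along `cs` and rise along `p`, so all products have the same degree `n + s - 1`,
  -- written without subtraction. The offset `s` absorbs the shift of `p` in the recursion.
  form-dot : ∀ {d s} {cs : Vector Carrier 3 → Vec Carrier n} {p : ℕ → Vector Carrier 3 → Carrier} →
    DescendingForms cs → (∀ i → IsForm (i ℕ.+ s) (p i)) → suc d ≡ n ℕ.+ s →
    IsForm d (λ v → dot (cs v) (λ i → p i v))
  form-dot [] p-form eq = form-0
  form-dot {p = p} (_∷_ {n = n} c-form cs-form) p-form ≡.refl = form-+
    (form-* c-form (p-form 0))
    (form-dot cs-form
      (λ i → ≡.subst (λ k → IsForm k (p (suc i))) (≡.sym (ℕ.+-suc i _)) (p-form (suc i)))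
      (≡.sym (ℕ.+-suc n _)))

  forms-newton : ∀ (r : ℕ → Carrier) {p : ℕ → Vector Carrier 3 → Carrier} →
    (∀ i → IsForm (suc i) (p i)) → ∀ n → DescendingForms (λ v → newton r (λ i → p i v) n)
  forms-newton r p-form zero    = form-const 1# ∷ []
  forms-newton r {p} p-form (suc n) =
    form-neg (form-scale (r (suc n)) (form-dot ih
      (λ i → ≡.subst (λ k → IsForm k (p i)) (≡.sym (ℕ.+-comm i 1)) (p-form i))
      (≡.cong suc (≡.sym (ℕ.+-comm n 1)))))
    ∷ ih
    where ih = forms-newton r p-form n

  -- From a form with a nonzero value to a curve

  removeMonomial : Monomial → Polynomial → Polynomial
  removeMonomial e = List.filter (λ t → ¬? (proj₂ t ≟ᵐ e))

  evaluate-remove : ∀ e f v →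
    evaluate f v ≈ coefficient f e * monomial e v + evaluate (removeMonomial e f) v
  evaluate-remove e [] v = sym (trans (+-identityʳ _) (zeroˡ _))
  evaluate-remove e ((c , d) ∷ f) v with d ≟ᵐ e
  ... | yes ≡.refl = trans (+-congˡ (evaluate-remove e f v))
    (solve 4 (λ c x k r → c :* x :+ (k :* x :+ r) := (c :+ k) :* x :+ r)
      refl c (monomial e v) (coefficient f e) (evaluate (removeMonomial e f) v))
  ... | no _ = begin
    c * monomial d v + evaluate f v
      ≈⟨ +-congˡ (evaluate-remove e f v) ⟩
    c * monomial d v + (coefficient f e * monomial e v + evaluate (removeMonomial e f) v)
      ≈⟨ solve 3 (λ x y z → x :+ (y :+ z) := y :+ (x :+ z))
           refl (c * monomial d v) (coefficient f e * monomial e v) (evaluate (removeMonomial e f) v) ⟩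
    coefficient f e * monomial e v + (c * monomial d v + evaluate (removeMonomial e f) v)
      ≈⟨ +-congʳ (*-congʳ (+-identityˡ _)) ⟨
    (0# + coefficient f e) * monomial e v + (c * monomial d v + evaluate (removeMonomial e f) v) ∎

  coefficient-remove-≡ : ∀ e f → coefficient (removeMonomial e f) e ≈ 0#
  coefficient-remove-≡ e [] = refl
  coefficient-remove-≡ e ((c , d) ∷ f) with d ≟ᵐ e in eq
  ... | yes _ = coefficient-remove-≡ e f
  -- The term survives the filter, and `coefficient` then tests `d` against `e` once more.
  ... | no  _ rewrite eq = trans (+-identityˡ _) (coefficient-remove-≡ e f)

  coefficient-remove-≢ : ∀ {d e} f → d ≢ e → coefficient (removeMonomial d f) e ≈ coefficient f e
  coefficient-remove-≢ [] d≢e = refl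
  coefficient-remove-≢ {d} {e} ((c , d′) ∷ f) d≢e with d′ ≟ᵐ d
  ... | no _ = +-congˡ (coefficient-remove-≢ f d≢e)
  ... | yes ≡.refl with d ≟ᵐ e
  ...   | yes d≡e = contradiction d≡e d≢e
  ...   | no  _   = trans (coefficient-remove-≢ f d≢e) (sym (+-identityˡ _))

  -- If the coefficient of the first monomial collects to 0, dropping all its terms preserves the
  -- values and shortens the polynomial. The bound `n` makes this recursion structural.
  nonzero-coefficient : ∀ {n} f v → length f ≤ n → ¬ evaluate f v ≈ 0# →
                        ∃ λ e → ¬ coefficient f e ≈ 0#
  nonzero-coefficient [] v _ ev≉0 = contradiction refl ev≉0
  nonzero-coefficient {suc n} f@((c , d) ∷ f′) v (s≤s f′≤n) ev≉0 with coefficient f d ≟ 0#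
  ... | no  cfd≉0 = d , cfd≉0
  ... | yes cfd≈0 with nonzero-coefficient {n} (removeMonomial d f) v
                        (ℕ.≤-trans (ℕ.≤-pred (List.filter-notAll (λ t → ¬? (proj₂ t ≟ᵐ d)) f
                                                   (here (λ d≢d → d≢d ≡.refl)))) f′≤n)
                        (λ ev≈0 → ev≉0 (trans (evaluate-remove d f v)
                          (trans (+-cong (trans (*-congʳ cfd≈0) (zeroˡ _)) ev≈0) (+-identityˡ 0#))))
  -- The monomial found differs from the dropped one, so its coefficient is the same in `f`.
  ...   | e , ce≉0 with d ≟ᵐ e
  ...     | yes ≡.refl = contradiction (coefficient-remove-≡ d f) ce≉0
  ...     | no  d≢e    = e , λ cfe≈0 → ce≉0 (trans (coefficient-remove-≢ f d≢e) cfe≈0)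

  coefficient-degree : ∀ {f e} → All (λ t → degree (proj₂ t) ≡ n) f → degree e ≢ n →
                       coefficient f e ≈ 0#
  coefficient-degree [] e≢n = refl
  coefficient-degree {f = (c , d) ∷ f} {e} (d-deg ∷ f-deg) e≢n with d ≟ᵐ e
  ... | yes ≡.refl = contradiction d-deg e≢n
  ... | no  _      = trans (+-identityˡ _) (coefficient-degree f-deg e≢n)

  curve : IsForm n φ → ∀ v → ¬ φ v ≈ 0# → Curve n
  curve (f , f-deg , f≈φ) v φv≉0 = record
    { polynomial  = f
    ; nonzero     = nonzero-coefficient f v ℕ.≤-refl (λ ev≈0 → φv≉0 (trans (sym (f≈φ v)) ev≈0))
    ; homogeneous = λ e → coefficient-degree f-deg
    }

  onCurve : ∀ (form : IsForm n φ) v (φv≉0 : ¬ φ v ≈ 0#) P → φ (vec P) ≈ 0# → P onCurve curve form v φv≉0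
  onCurve (f , f-deg , f≈φ) v φv≉0 P φP≈0 = trans (f≈φ (vec P)) φP≈0

-- Lists without repetition

lookup-injective : ∀ {a} {A : Set a} {xs : List A} → Unique xs → ∀ {i j} →
                   List.lookup xs i ≡ List.lookup xs j → i ≡ j
lookup-injective (x∉xs ∷ u) {zero}  {zero}  eq = ≡.refl
lookup-injective (x∉xs ∷ u) {zero}  {suc j} eq = contradiction eq (All.lookup x∉xs (∈-lookup j))
lookup-injective (x∉xs ∷ u) {suc i} {zero}  eq = contradiction (≡.sym eq) (All.lookup x∉xs (∈-lookup i))
lookup-injective (x∉xs ∷ u) {suc i} {suc j} eq = ≡.cong suc (lookup-injective u eq)

-- Sums of powers of heights along the lines through Q

module Pencil {q a b} (F : FiniteField q a b) (Q : PG2.Point F) where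

  open FiniteField F hiding (zero)
  open PG2 F
  open Exp semiring using (^-congˡ; _^_)
  open Sum semiring using (sum; sum-cong-≋; *-distribˡ-sum)
  open GroupProperties +-group using (x∙y⁻¹≈ε⇒x≈y)
  open CommutativeSum +-commutativeMonoid using (∑-distrib-+)
  open IntegerImage commutativeRing
  open NewtonIdentities commutativeRing
  open FieldProperties F
  open Forms F
  open ≈-Reasoning setoid

  private
    i₀ = proj₁ (nonzero Q)

  infix 8 _⋆_
  _⋆_ : Vector Carrier 3 → Vector Carrier 3 → Carrier
  l ⋆ v = sum (λ i → l i * v i)

  -- The linear form y with y(Q) = 1 is a coordinate not vanishing at `Q`, divided by its value
  -- there.
  height : Vector Carrier 3 → Carrier
  height v = recip (vec Q i₀) * v i₀

  height-Q : height (vec Q) ≈ 1#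
  height-Q = recip-inverse (proj₂ (nonzero Q))

  height-form : IsForm 1 height
  height-form = form-scale _ (form-coordinate i₀)

  -- If l does not pass through Q, it meets the line joining v and Q in the point
  -- v + s Q with s = crossing l v; otherwise the value is 0, as recip 0# = 0#.
  crossing : Line → Vector Carrier 3 → Carrier
  crossing l v = - (vec l ⋆ v * recip (vec l ⋆ vec Q))

  -- Abstract for the same reason as recip.
  abstract
    throughQ? : ∀ l → Dec (Q ∈ pointsOf l)
    throughQ? l = Subset.member? (pointsOf l) Q

  -- The formula makes sense for every `v`, including multiples of `Q`, where there is no joining
  -- line.
  lineSum : Line → ℕ → Vector Carrier 3 → Carrier
  lineSum l j v = if does (throughQ? l) then 0# else (height v + crossing l v) ^ suc j

  codewordSum : List (ℤ × Line) → ℕ → Vector Carrier 3 → Carrier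
  codewordSum []            j v = 0#
  codewordSum ((c , l) ∷ t) j v = ι c * lineSum l j v + codewordSum t j v

  lineSum-form : ∀ l j → IsForm (suc j) (lineSum l j)
  lineSum-form l j with does (throughQ? l)
  ... | true  = form-0
  ... | false = form-^ (suc j) (form-+ height-form (form-cong
    (λ v → solve 2 (λ x y → :- y :* x := :- (x :* y)) refl (vec l ⋆ v) (recip (vec l ⋆ vec Q)))
    (form-scale (- recip (vec l ⋆ vec Q)) (form-sum (λ i → form-scale (vec l i) (form-coordinate i))))))

  codewordSum-form : ∀ t j → IsForm (suc j) (codewordSum t j)
  codewordSum-form []            j = form-0
  codewordSum-form ((c , l) ∷ t) j = form-+ (form-scale (ι c) (lineSum-form l j)) (codewordSum-form t j)

  -- At `Q` the height is 1 and the crossing parameter is -1, and the exponent is positive.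
  lineSum-Q : ∀ l j → lineSum l j (vec Q) ≈ 0#
  lineSum-Q l j with throughQ? l
  ... | yes _    = refl
  ... | no  lQ≉0 = begin
    h * h ^ j    ≈⟨ *-congʳ (+-cong height-Q (-‿cong (trans (*-comm _ _) (recip-inverse lQ≉0)))) ⟩
    (1# - 1#) * h ^ j ≈⟨ *-congʳ (-‿inverseʳ 1#) ⟩
    0# * h ^ j ≈⟨ zeroˡ _ ⟩
    0# ∎
    where h = height (vec Q) + crossing l (vec Q)

  codewordSum-Q : ∀ t j → codewordSum t j (vec Q) ≈ 0#
  codewordSum-Q []            j = refl
  codewordSum-Q ((c , l) ∷ t) j = begin
    ι c * lineSum l j (vec Q) + codewordSum t j (vec Q)
      ≈⟨ +-cong (trans (*-congˡ (lineSum-Q l j)) (zeroʳ _)) (codewordSum-Q t j) ⟩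
    0# + 0# ≈⟨ +-identityˡ 0# ⟩
    0#      ∎

  ⋆-linear : ∀ l v s w → l ⋆ (λ i → v i + s * w i) ≈ l ⋆ v + s * l ⋆ w
  ⋆-linear l v s w = begin
    sum (λ i → l i * (v i + s * w i))
      ≈⟨ sum-cong-≋ (λ i → solve 4 (λ l v s w → l :* (v :+ s :* w) := l :* v :+ s :* (l :* w))
                             refl (l i) (v i) s (w i)) ⟩
    sum (λ i → l i * v i + s * (l i * w i))  ≈⟨ ∑-distrib-+ (λ i → l i * v i) (λ i → s * (l i * w i)) ⟩
    l ⋆ v + sum (λ i → s * (l i * w i))      ≈⟨ +-congˡ (*-distribˡ-sum s (λ i → l i * w i)) ⟨
    l ⋆ v + s * l ⋆ w                        ∎

  indicator : ∀ {m} → Subset points m → Point → Carrier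
  indicator A P = ι (χ A P)

  indicator-∈ : ∀ {m} (A : Subset points m) P → P ∈ A → indicator A P ≈ 1#
  indicator-∈ A P P∈A rewrite dec-true (Subset.member? A P) P∈A = refl

  indicator-∉ : ∀ {m} (A : Subset points m) P → ¬ P ∈ A → indicator A P ≈ 0#
  indicator-∉ A P P∉A rewrite dec-false (Subset.member? A P) P∉A = refl

  -- The points other than Q on the line joining P and Q

  module Through (P : Point) (P≁Q : ¬ P ∼ Q) where

    v : Vector Carrier 3
    v = vec P

    -- With `c` nonzero, either `d` is 0 and the vector of `P` would vanish, or `Q` would be -c/d
    -- times `P`.
    independent : ∀ c d → (∀ i → c * v i + d * vec Q i ≈ 0#) → c ≈ 0#
    independent c d eq with c ≟ 0# | d ≟ 0#
    ... | yes c≈0 | _       = c≈0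
    ... | no  c≉0 | yes d≈0 = contradiction
      (x*y≈0⇒y≈0 c≉0 (begin
        c * v i                 ≈⟨ +-identityʳ _ ⟨
        c * v i + 0#            ≈⟨ +-congˡ (trans (*-congʳ d≈0) (zeroˡ _)) ⟨
        c * v i + d * vec Q i   ≈⟨ eq i ⟩
        0#                      ∎))
      (proj₂ (nonzero P))
      where i = proj₁ (nonzero P)
    ... | no  c≉0 | no  d≉0 = contradiction
      (- (recip d * c) , e≉0 , λ i → begin
        vec Q i
          ≈⟨ +-identityʳ _ ⟨
        vec Q i + 0#
          ≈⟨ +-congˡ (trans (*-congˡ (eq i)) (zeroʳ _)) ⟨
        vec Q i + - recip d * (c * v i + d * vec Q i)
          ≈⟨ solve 5 (λ w r d c v →
               w :+ :- r :* (c :* v :+ d :* w) := (con (+ 1) :- r :* d) :* w :+ :- (r :* c) :* v)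
               refl (vec Q i) (recip d) d c (v i) ⟩
        (1# - recip d * d) * vec Q i + - (recip d * c) * v i
          ≈⟨ +-congʳ (trans (*-congʳ (trans (+-congˡ (-‿cong (recip-inverse d≉0))) (-‿inverseʳ 1#))) (zeroˡ _)) ⟩
        0# + - (recip d * c) * v i
          ≈⟨ +-identityˡ _ ⟩
        - (recip d * c) * v i ∎)
      P≁Q
      where
      e≉0 : ¬ - (recip d * c) ≈ 0#
      e≉0 e≈0 = c≉0 (begin
        c   ≈⟨ *-identityˡ c ⟨
        1# * c   ≈⟨ *-congʳ (recip-inverse d≉0) ⟨
        recip d * d * c ≈⟨ solve 3 (λ r d c → r :* d :* c := :- d :* :- (r :* c)) refl (recip d) d c ⟩
        - d * - (recip d * c) ≈⟨ *-congˡ e≈0 ⟩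
        - d * 0# ≈⟨ zeroʳ _ ⟩
        0# ∎)

    shift : Carrier → Vector Carrier 3
    shift s i = v i + s * vec Q i

    point : Carrier → Point
    point s = record
      { vec     = shift s
      ; nonzero = Fin.¬∀⟶∃¬ 3 (λ i → shift s i ≈ 0#) (λ i → shift s i ≟ 0#)
          (λ shift≈0 → 1≉0 (independent 1# s (λ i → trans (+-congʳ (*-identityˡ _)) (shift≈0 i))))
      }

    point≁Q : ∀ s → ¬ point s ∼ Q
    point≁Q s (c , c≉0 , Q≈) = c≉0 (independent c (c * s - 1#) λ i → begin
      c * v i + (c * s - 1#) * vec Q i
        ≈⟨ solve 4 (λ c v s w → c :* v :+ (c :* s :- con (+ 1)) :* w := c :* (v :+ s :* w) :- w)
             refl c (v i) s (vec Q i) ⟩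
      c * shift s i - vec Q i    ≈⟨ +-congʳ (Q≈ i) ⟨
      vec Q i - vec Q i          ≈⟨ -‿inverseʳ _ ⟩
      0#                         ∎)

    -- Comparing coefficients of `v` shows that the scalar between the two vectors is 1; then a
    -- nonzero coordinate of `Q` can be cancelled.
    point-injective : ∀ {s t} → point s ∼ point t → s ≈ t
    point-injective {s} {t} (c , c≉0 , t≈cs) = sym (x∙y⁻¹≈ε⇒x≈y t s
      (x*y≈0⇒y≈0 (proj₂ (nonzero Q)) (begin
        w * (t - s)
          ≈⟨ solve 5 (λ w t s c v →
               w :* (t :- s) := (v :+ t :* w :- c :* (v :+ s :* w)) :+ (c :- con (+ 1)) :* (v :+ s :* w))
               refl w t s c (v i₀) ⟩
        shift t i₀ - c * shift s i₀ + (c - 1#) * shift s i₀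
          ≈⟨ +-cong (trans (+-congʳ (t≈cs i₀)) (-‿inverseʳ _)) (trans (*-congʳ c-1≈0) (zeroˡ _)) ⟩
        0# + 0#   ≈⟨ +-identityˡ 0# ⟩
        0#        ∎)))
      where
      w = vec Q i₀
      c-1≈0 : c - 1# ≈ 0#
      c-1≈0 = independent (c - 1#) (c * s - t) λ i → begin
        (c - 1#) * v i + (c * s - t) * vec Q i
          ≈⟨ solve 5 (λ c v s t w →
               (c :- con (+ 1)) :* v :+ (c :* s :- t) :* w := c :* (v :+ s :* w) :- (v :+ t :* w))
               refl c (v i) s t (vec Q i) ⟩
        c * shift s i - shift t i  ≈⟨ +-congˡ (-‿cong (t≈cs i)) ⟩
        c * shift s i - c * shift s i ≈⟨ -‿inverseʳ _ ⟩
        0# ∎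

    point-0 : ∀ {s} → s ≈ 0# → P ∼ point s
    point-0 s≈0 = 1# , 1≉0 , λ i → trans (+-congˡ (trans (*-congʳ s≈0) (zeroˡ _)))
      (trans (+-identityʳ _) (sym (*-identityˡ _)))

    pt : Fin q → Point
    pt i = point (element i)

    -- The base is the height of `pt i`, because `height` is linear with value 1 at `Q`.
    weight : ℕ → Fin q → Carrier
    weight j i = (height v + element i) ^ suc j

    sum-weight : ∀ j → 3 ℕ.+ j ≤ q → sum (weight j) ≈ 0#
    sum-weight j j+3≤q = trans
      (sym (sum-bijection (_^ suc j) (λ x → height v + x) (λ x → x - height v) (^-congˡ (suc j)) +-congˡ +-congʳ
        (λ x → solve 2 (λ h x → h :+ (x :- h) := x) refl (height v) x)
        (λ x → solve 2 (λ h x → h :+ x :- h := x) refl (height v) x)))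
      (sum-of-powers j j+3≤q)

    -- If `l` contains `Q` and `P`, all `pt i` are on it and their heights run through the field, so
    -- the sum vanishes. If `l` contains `Q` but not `P`, no `pt i` is on it. Otherwise exactly one
    -- is, with parameter `crossing l v`.
    sum-indicator-line : ∀ l j → 3 ℕ.+ j ≤ q →
      sum (λ i → indicator (pointsOf l) (pt i) * weight j i) ≈ lineSum l j v
    sum-indicator-line l j j+3≤q with throughQ? l | (vec l ⋆ v) ≟ 0#
    ... | yes lQ≈0 | yes lv≈0 = trans
      (sum-cong-≋ (λ i → trans (*-congʳ (indicator-∈ (pointsOf l) (pt i)
        (trans (⋆-linear (vec l) v _ (vec Q))
          (trans (+-cong lv≈0 (trans (*-congˡ lQ≈0) (zeroʳ _))) (+-identityˡ 0#)))))
        (*-identityˡ (weight j i))))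
      (sum-weight j j+3≤q)
    ... | yes lQ≈0 | no lv≉0 = sum-zero λ i → trans
      (*-congʳ (indicator-∉ (pointsOf l) (pt i) λ l·pt≈0 → lv≉0 (begin
        vec l ⋆ v ≈⟨ +-identityʳ _ ⟨
        vec l ⋆ v + 0# ≈⟨ +-congˡ (trans (*-congˡ lQ≈0) (zeroʳ _)) ⟨
        vec l ⋆ v + element i * vec l ⋆ vec Q ≈⟨ ⋆-linear (vec l) v _ (vec Q) ⟨
        vec l ⋆ shift (element i) ≈⟨ l·pt≈0 ⟩
        0# ∎)))
      (zeroˡ _)
    ... | no lQ≉0 | _ = begin
      sum (λ i → indicator (pointsOf l) (pt i) * weight j i)
        ≈⟨ sum-single k (λ i i≢k → trans (*-congʳ (indicator-∉ (pointsOf l) (pt i) (i≢k ∘ unique i))) (zeroˡ _)) ⟩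
      indicator (pointsOf l) (pt k) * weight j k
        ≈⟨ *-cong (indicator-∈ (pointsOf l) (pt k) pt-k∈l) (^-congˡ (suc j) (+-congˡ (element-index _))) ⟩
      1# * (height v + crossing l v) ^ suc j
        ≈⟨ *-identityˡ _ ⟩
      (height v + crossing l v) ^ suc j ∎
      where
      lQ = vec l ⋆ vec Q
      lv = vec l ⋆ v
      k = index (crossing l v)
      pt-k∈l : pt k ∈ pointsOf l
      pt-k∈l = begin
        vec l ⋆ shift (element k)  ≈⟨ ⋆-linear (vec l) v _ (vec Q) ⟩
        lv + element k * lQ        ≈⟨ +-congˡ (*-congʳ (element-index _)) ⟩
        lv + - (lv * recip lQ) * lQ
          ≈⟨ solve 3 (λ x r y → x :+ :- (x :* r) :* y := x :* (con (+ 1) :- r :* y)) refl lv (recip lQ) lQ ⟩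
        lv * (1# - recip lQ * lQ)  ≈⟨ *-congˡ (trans (+-congˡ (-‿cong (recip-inverse lQ≉0))) (-‿inverseʳ 1#)) ⟩
        lv * 0#                    ≈⟨ zeroʳ _ ⟩
        0#                         ∎
      unique : ∀ i → pt i ∈ pointsOf l → i ≡ k
      unique i pt-i∈l = element-injective (x∙y⁻¹≈ε⇒x≈y _ _ (x*y≈0⇒y≈0 lQ≉0 (begin
        lQ * (element i - element k)
          ≈⟨ solve 4 (λ y s t x → y :* (s :- t) := x :+ s :* y :- (x :+ t :* y)) refl lQ (element i) (element k) lv ⟩
        lv + element i * lQ - (lv + element k * lQ)
          ≈⟨ +-cong (trans (sym (⋆-linear (vec l) v _ (vec Q))) pt-i∈l)
                    (-‿cong (trans (sym (⋆-linear (vec l) v _ (vec Q))) pt-k∈l)) ⟩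
        0# - 0#  ≈⟨ -‿inverseʳ 0# ⟩
        0#       ∎)))

    sum-combination : ∀ t j → 3 ℕ.+ j ≤ q →
      sum (λ i → ι (combination t (pt i)) * weight j i) ≈ codewordSum t j v
    sum-combination []            j j+3≤q = sum-zero {n = q} (λ i → zeroˡ (weight j i))
    sum-combination ((c , l) ∷ t) j j+3≤q = begin
      sum (λ i → ι (c ℤ.* χ (pointsOf l) (pt i) ℤ.+ combination t (pt i)) * weight j i)
        ≈⟨ sum-cong-≋ (λ i → trans
             (*-congʳ (trans (ι-+ (c ℤ.* χ (pointsOf l) (pt i)) (combination t (pt i)))
                             (+-congʳ (ι-* c (χ (pointsOf l) (pt i))))))
             (solve 4 (λ c x y w → (c :* x :+ y) :* w := c :* (x :* w) :+ y :* w)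
               refl (ι c) (indicator (pointsOf l) (pt i)) (ι (combination t (pt i))) (weight j i))) ⟩
      sum (λ i → ι c * (indicator (pointsOf l) (pt i) * weight j i) + ι (combination t (pt i)) * weight j i)
        ≈⟨ ∑-distrib-+ (λ i → ι c * (indicator (pointsOf l) (pt i) * weight j i))
                         (λ i → ι (combination t (pt i)) * weight j i) ⟩
      sum (λ i → ι c * (indicator (pointsOf l) (pt i) * weight j i)) +
      sum (λ i → ι (combination t (pt i)) * weight j i)
        ≈⟨ +-cong (trans (sym (*-distribˡ-sum (ι c) (λ i → indicator (pointsOf l) (pt i) * weight j i)))
                         (*-congˡ (sum-indicator-line l j j+3≤q)))
                  (sum-combination t j j+3≤q) ⟩
      ι c * lineSum l j v + codewordSum t j v ∎

    module _ {m} (X : Subset points m) where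

      members : List (Fin q)
      members = List.filter (λ i → Subset.member? X (pt i)) (List.allFin q)

      heights : List Carrier
      heights = List.map (λ i → height v + element i) members

      powerSum-heights : ∀ j → powerSum heights (suc j) ≈ sum (λ i → indicator X (pt i) * weight j i)
      powerSum-heights j = trans
        (powerSum-filter (λ i → Subset.member? X (pt i)) (λ i → height v + element i) id (suc j))
        (sum-cong-≋ term)
        where
        term : ∀ i → (if does (Subset.member? X (pt i)) then weight j i else 0#) ≈ indicator X (pt i) * weight j i
        term i with does (Subset.member? X (pt i))
        ... | true  = sym (*-identityˡ _)
        ... | false = sym (zeroˡ _)

      -- `P` is the point of parameter 0, up to `∼`.
      height∈heights : P ∈ X → Any (height v ≈_) heights
      height∈heights P∈X = Any.map⁺ (Any.map
        (λ { ≡.refl → sym (trans (+-congˡ (element-index 0#)) (+-identityʳ _)) })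
        (∈-filter⁺ (λ i → Subset.member? X (pt i)) (∈-allFin (index 0#))
          (Subset.respects X {P} {pt (index 0#)} (point-0 (element-index 0#)) P∈X)))

      -- As `l` joins `Q` and `P`, every listed `pt i` is a point of `X` on `l` other than `Q`, and
      -- distinct parameters give distinct points; so the list injects into a set of size `n`.
      length-heights : ∀ {l n} → Q ∈ pointsOf l → P ∈ pointsOf l →
        HasSize (On.setoid points (proj₁ {B = λ R → R ∈ X × ¬ R ∼ Q × R ∈ pointsOf l})) n →
        length heights ≤ n
      length-heights {l} {n} Q∈l P∈l size′ = ≡.subst (_≤ n) (≡.sym (List.length-map _ members))
        (Fin.injective⇒≤ {f = λ i → Inverse.to size′ (member i)} λ {i} {j} eq →
          lookup-injective (Unique.filter⁺ (λ i → Subset.member? X (pt i)) (Unique.allFin⁺ q))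
            (element-injective (point-injective
              (Injection.injective (Inverse⇒Injection size′) {member i} {member j} eq))))
        where
        member : Fin (length members) → ∃ λ R → R ∈ X × ¬ R ∼ Q × R ∈ pointsOf l
        member i = pt k ,
          proj₂ (∈-filter⁻ (λ i → Subset.member? X (pt i)) {xs = List.allFin q} (∈-lookup i)) ,
          point≁Q (element k) ,
          trans (⋆-linear (vec l) v _ (vec Q))
            (trans (+-cong P∈l (trans (*-congˡ Q∈l) (zeroʳ _))) (+-identityˡ 0#))
          where k = List.lookup members i

  -- The curve attached to a codeword

  module Codeword (p : ℕ) (p-prime : Prime p) (p·1≈0 : p · 1# ≈ 0#) {m} (X : Subset points m)
    (t : List (ℤ × Line)) (X≡t : ∀ P → + p ℤ.∣ χ X P ℤ.- combination t P)
    (k : ℕ) (k+2≤q : k ℕ.+ 2 ≤ q) (k+1≤p : k ℕ.+ 1 ≤ p) where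

    open Characteristic p-prime p·1≈0

    reciprocal : ℕ → Carrier
    reciprocal n = recip (n · 1#)

    -- `newton` lists c_k, ..., c₀ in this order, so `horner` yields ∑ c_j y^(k-j).
    curveForm : Vector Carrier 3 → Carrier
    curveForm v = horner (height v) (newton reciprocal (λ j → codewordSum t j v) k)

    isForm : IsForm k curveForm
    isForm = form-horner height-form (forms-newton reciprocal (codewordSum-form t) k)

    reciprocal-inverse : ∀ {j} → j < k → reciprocal (suc j) * suc j · 1# ≈ 1#
    reciprocal-inverse j<k = recip-inverse (n·1≉0 (ℕ.<-≤-trans (s≤s j<k) (≡.subst (_≤ p) (ℕ.+-comm k 1) k+1≤p)))

    -- The coefficients depend only on the first `k` power sums, so any list with these power sums
    -- may be used, whatever its length.
    curveForm-elementary : ∀ v ys → (∀ {j} → j < k → codewordSum t j v ≈ powerSum ys (suc j)) →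
      curveForm v ≈ horner (height v) (downFrom (elementary ys) k)
    curveForm-elementary v ys sums = horner-cong refl (newton-elementary ys reciprocal-inverse sums ℕ.≤-refl)

    -- At `Q` the sums are all 0, like the power sums of the empty list, and only y(Q)^k remains.
    curveForm-Q : curveForm (vec Q) ≈ 1#
    curveForm-Q = begin
      curveForm (vec Q)     ≈⟨ curveForm-elementary (vec Q) [] (λ {j} _ → codewordSum-Q t j) ⟩
      horner (height (vec Q)) (downFrom (elementary []) k)  ≈⟨ horner-elementary-[] _ k ⟩
      height (vec Q) ^ k    ≈⟨ ^-congˡ k height-Q ⟩
      1# ^ k                ≈⟨ 1^ k ⟩
      1#                    ∎
      where
      1^ : ∀ k → 1# ^ k ≈ 1#
      1^ zero    = refl
      1^ (suc k) = trans (*-identityˡ _) (1^ k)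

    -- The sums at `P` are the power sums of the heights of `X` on `l`. There are at most `k` of
    -- these heights, and that of `P` is among them.
    curveForm-root : ∀ P → P ∈ X → ¬ P ∼ Q → ∀ {l} → Q ∈ pointsOf l → P ∈ pointsOf l →
      AtMost points (+ k) (λ R → R ∈ X × ¬ R ∼ Q × R ∈ pointsOf l) → curveForm (vec P) ≈ 0#
    curveForm-root P P∈X P≁Q {l} Q∈l P∈l (n , size′ , n≤k) = trans
      (curveForm-elementary (vec P) (heights X) sums)
      (horner-elementary-root (heights X)
        (ℕ.≤-trans (length-heights X {l} Q∈l P∈l size′) (ℤ.drop‿+≤+ n≤k))
        (height∈heights X P∈X))
      where
      open Through P P≁Q
      sums : ∀ {j} → j < k → codewordSum t j (vec P) ≈ powerSum (heights X) (suc j)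
      sums {j} j<k = begin
        codewordSum t j (vec P)
          -- From `j < k` and `k + 2 ≤ q`, the exponent `suc j` is at most `q - 2`.
          ≈⟨ sum-combination t j (ℕ.≤-trans (≡.subst (3 ℕ.+ j ≤_) (ℕ.+-comm 2 k) (s≤s (s≤s j<k))) k+2≤q) ⟨
        sum (λ i → ι (combination t (pt i)) * weight j i)
          ≈⟨ sum-cong-≋ (λ i → *-congʳ (p∣i-j⇒ιi≈ιj (χ X (pt i)) (combination t (pt i)) (X≡t (pt i)))) ⟨
        sum (λ i → indicator X (pt i) * weight j i)
          ≈⟨ powerSum-heights X j ⟨
        powerSum (heights X) (suc j) ∎

-- Passage from an integer bound to a natural degree

open import Data.Integer.Base using (_-_; _⊓_) renaming (_≤_ to _≤ᶻ_)
open import Data.Nat.Base using (_^_)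

m≤n-o⇒m+o≤n : ∀ m n o → + m ≤ᶻ + n - + o → m ℕ.+ o ≤ n
m≤n-o⇒m+o≤n m n o m≤n-o = ℤ.drop‿+≤+ (≡.subst (λ i → + (m ℕ.+ o) ≤ᶻ i) eq (ℤ.+-monoˡ-≤ (+ o) m≤n-o))
  where
  eq : + n - + o ℤ.+ + o ≡ + n
  eq = ≡.trans (ℤ.+-assoc (+ n) (ℤ.- + o) (+ o))
         (≡.trans (≡.cong (λ i → + n ℤ.+ i) (ℤ.+-inverseˡ (+ o))) (ℤ.+-identityʳ (+ n)))

theorem5p4 : ∀ {a b m₁ m₂} (p h q : ℕ) → Prime p → 1 ≤ h → q ≡ p ^ h →
    (F : FiniteField q a b) → let open PG2 F in
    (X : Subset points m₁) → C₁ p (χ X) →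
    (Q : Point) →
    (k : ℤ) → k ≤ᶻ (+ q - + 2) ⊓ (+ p - + 1) →
    (E : Subset lines m₂) → (∃ λ l → l ∈ E) →
    (∀ l → l ∈ E → Q ∈ pointsOf l) →
    (∀ l → l ∈ E → AtMost points k (λ P → P ∈ X × ¬ P ∼ Q × P ∈ pointsOf l)) →
    ∃ λ n → + n ≡ k × Σ (Curve n) λ Γ →
    ∀ P → P ∈ X → ¬ P ∼ Q → (∃ λ l → l ∈ E × P ∈ pointsOf l) → P onCurve Γ
theorem5p4 p h q p-prime _ q≡p^h F X (t , X≡t) Q (+ k) k≤ E _ Q∈E atMost =
  k , ≡.refl , curve isForm (vec Q) formQ≉0 ,
  λ P P∈X P≁Q (l , l∈E , P∈l) →
    onCurve isForm (vec Q) formQ≉0 P (curveForm-root P P∈X P≁Q {l} (Q∈E l l∈E) P∈l (atMost l l∈E))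
  where
  open PG2 F using (vec)
  open FiniteField F using (_≈_; 0#; 1#; 1≉0; sym; trans; commutativeRing)
  open FieldProperties F using (p^h·1≈0⇒p·1≈0; q·1≈0)
  open IntegerImage commutativeRing using (_·_)
  open Forms F using (curve; onCurve)
  p·1≈0 : p · 1# ≈ 0#
  p·1≈0 = p^h·1≈0⇒p·1≈0 p h (≡.subst (λ n → n · 1# ≈ 0#) q≡p^h q·1≈0)
  open Pencil.Codeword F Q p p-prime p·1≈0 X t X≡t k
    -- The bound by `q - 2` makes the relevant power sums of the field vanish; the bound by `p - 1`
    -- makes 1, ..., `k` invertible.
    (m≤n-o⇒m+o≤n k q 2 (ℤ.≤-trans k≤ (ℤ.i⊓j≤i (+ q - + 2) (+ p - + 1))))
    (m≤n-o⇒m+o≤n k p 1 (ℤ.≤-trans k≤ (ℤ.i⊓j≤j (+ q - + 2) (+ p - + 1))))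
  formQ≉0 : ¬ curveForm (vec Q) ≈ 0#
  formQ≉0 form≈0 = 1≉0 (trans (sym curveForm-Q) form≈0)
-- The degree cannot be negative: a line of the non-empty set `E` would carry a natural number of
-- points bounded by a negative integer.
theorem5p4 p h q _ _ _ F X _ Q ℤ.-[1+ k ] _ E (l , l∈E) _ atMost
  with atMost l l∈E
... | n , _ , ()
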